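{- Let \(G\) be a finite, simple, connected graph with maximum degree \(\Delta(G)\leq 4\), and suppose \(G\) is not (isomorphic to) the graph of the octahedron. Then \(G\) is convergent, i.e. there exist integers \(0\le m<n\) such that \(K^{m}(G)\cong K^{n}(G)\).
   Context: All graphs are finite and simple. A clique of a graph is a maximal complete subgraph. The clique graph \(K(G)\) is the intersection graph of the cliques of \(G\) (vertices are the cliques of \(G\), two adjacent iff they share a vertex). Iterated clique graphs: \(K^{0}(G)=G\), \(K^{n}(G)=K(K^{n-1}(G))\). \(G\) is convergent if there are \(m<n\) with \(K^{m}(G)\cong K^{n}(G)\) (equivalently, the iterated clique graphs take only finitely many isomorphism types), and divergent otherwise. The octahedron is the complete tripartite graph \(K_{2,2,2}\) (6 vertices, 4-regular). -}

module Defs where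

open import Data.Nat using (ℕ; zero; suc; _≤_; _<_; _/_)
open import Data.Bool using (Bool; true; false; _∧_; _∨_; not; if_then_else_)
open import Data.Fin using (Fin; toℕ)
open import Data.Fin.Properties using (_≟_)
open import Data.Vec using (Vec; []; _∷_; lookup)
open import Data.List using (List; []; _∷_; map; _++_; filter; length; allFin; lookup)
open import Data.Bool.ListAction using (all; any)
open import Data.Product using (Σ; ∃; _×_; _,_)
open import Relation.Binary.PropositionalEquality using (_≡_)
open import Relation.Nullary.Decidable using (⌊_⌋)
open import Function.Bundles using (Inverse)
open import Function using (_∘_)

record Graph : Set where
  constructor mkGraph
  field
    size : ℕ
    adj  : Fin size → Fin size → Bool
open Graph public

IsSimple : Graph → Set
IsSimple G = (∀ i j → adj G i j ≡ adj G j i) × (∀ i → adj G i i ≡ false)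

_==_ : ∀ {n} → Fin n → Fin n → Bool
i == j = ⌊ i ≟ j ⌋

VSet : ℕ → Set
VSet n = Vec Bool n

_∈ᵇ_ : ∀ {n} → Fin n → VSet n → Bool
v ∈ᵇ S = Data.Vec.lookup S v

allSubsets : (n : ℕ) → List (VSet n)
allSubsets zero    = [] ∷ []
allSubsets (suc n) = map (false ∷_) (allSubsets n) ++ map (true ∷_) (allSubsets n)

module _ (G : Graph) where
  private
    n = size G
    vs = allFin n

  isComplete : VSet n → Bool
  isComplete S = all (λ i → all (λ j →
      not (i ∈ᵇ S ∧ j ∈ᵇ S ∧ not (i == j)) ∨ adj G i j) vs) vs

  isNonempty : VSet n → Bool
  isNonempty S = any (λ i → i ∈ᵇ S) vs

  isMaximal : VSet n → Bool
  isMaximal S = all (λ v → not (not (v ∈ᵇ S) ∧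
      all (λ u → not (u ∈ᵇ S) ∨ adj G v u) vs)) vs

  isClique : VSet n → Bool
  isClique S = isNonempty S ∧ isComplete S ∧ isMaximal S

  -- the list of all cliques of G (each exactly once)
  cliques : List (VSet n)
  cliques = filter (λ S → isClique S Data.Bool.≟ true) (allSubsets n)

  meets : VSet n → VSet n → Bool
  meets S T = any (λ v → v ∈ᵇ S ∧ v ∈ᵇ T) vs

K : Graph → Graph
K G = mkGraph (length (cliques G))
  (λ i j → not (i == j) ∧ meets G (Data.List.lookup (cliques G) i)
                                   (Data.List.lookup (cliques G) j))

Kⁿ : ℕ → Graph → Graph
Kⁿ zero    G = G
Kⁿ (suc k) G = K (Kⁿ k G)

_≅_ : Graph → Graph → Set
G ≅ H = Σ (Inverse (Data.Fin.Properties.≡-setoid (size G))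
                   (Data.Fin.Properties.≡-setoid (size H))) λ f →
          ∀ i j → adj G i j ≡ adj H (Inverse.to f i) (Inverse.to f j)

degree : (G : Graph) → Fin (size G) → ℕ
degree G v = length (filter (λ u → adj G v u Data.Bool.≟ true) (allFin (size G)))

MaxDegreeAtMost : ℕ → Graph → Set
MaxDegreeAtMost d G = ∀ v → degree G v ≤ d

data Reachable (G : Graph) : Fin (size G) → Fin (size G) → Set where
  here : ∀ {v} → Reachable G v v
  step : ∀ {u v w} → adj G u v ≡ true → Reachable G v w → Reachable G u w

Connected : Graph → Set
Connected G = Σ (Fin (size G)) (λ _ → ⊤') × (∀ u v → Reachable G u v)
  where
    open import Data.Unit using () renaming (⊤ to ⊤')

-- the octahedron K_{2,2,2}: vertices 0..5, parts {0,1},{2,3},{4,5};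
-- distinct vertices adjacent iff in different parts
octahedron : Graph
octahedron = mkGraph 6 (λ i j → not ⌊ Data.Nat._≟_ (toℕ i / 2) (toℕ j / 2) ⌋)

Convergent : Graph → Set
Convergent G = Σ ℕ λ m → Σ ℕ λ n → (m < n) × (Kⁿ m G ≅ Kⁿ n G)

{-# OPTIONS --safe #-}

-- The second clique graph of G is clique-Helly, and clique-Helly graphs are convergent.
--
-- If H is clique-Helly, then every clique of K(H) consists of all the cliques of H through one
-- vertex.  Choosing such a vertex embeds K²(H) in H as an induced subgraph, and K(H) is again
-- clique-Helly; so the sizes of H, K²(H), K⁴(H), … decrease until H ≅ K²(H).
--
-- A pairwise intersecting family of cliques without a common vertex yields a hexad, a triangle T with
-- an ear on each edge that is not adjacent to the opposite vertex of T.  When Δ ≤ 4 a hexad saturates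
-- the vertices of T, and its ears are not pairwise adjacent unless G is the octahedron.  Hence a
-- vertex of K²(G) is either the set of cliques through some vertex of G, or the set of cliques
-- containing two vertices of the triangle of a hexad.  Analysing how these two kinds can be adjacent
-- shows that K²(G) contains no hexad.
module Submission where

open import Defs
open import Data.Bool using (Bool; true; false; not; _∧_; _∨_) renaming (_≟_ to _≟ᵇ_)
open import Data.Bool.ListAction using (all; any)
open import Data.Bool.Properties using (T-≡; ⇔→≡; ∧-zeroʳ; ¬-not)
open import Data.Empty using (⊥; ⊥-elim)
open import Data.Fin using (Fin; zero; suc; toℕ; punchOut)
open import Data.Fin.Patterns using (0F; 1F; 2F; 3F; 4F; 5F)
open import Data.Fin.Properties using (_≟_; any?; injective⇒≤; punchOut-injective; toℕ-injective)
open import Data.List using (List; []; _∷_; length; map; lookup; filter; allFin)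
open import Data.List.Membership.Propositional using (find; lose) renaming (_∈_ to _∈ₗ_)
open import Data.List.Membership.DecPropositional using (_∈?_)
open import Data.List.Membership.Propositional.Properties
  using (∈-map⁺; ∈-map⁻; ∈-++⁺ˡ; ∈-++⁺ʳ; ∈-filter⁺; ∈-filter⁻; ∈-lookup; ∈-allFin)
open import Data.List.Relation.Unary.All as All using (All; []; _∷_)
open import Data.List.Relation.Unary.All.Properties using (all⁺; all⁻; ¬All⇒Any¬)
open import Data.List.Relation.Unary.AllPairs using ([]; _∷_)
open import Data.List.Relation.Unary.Any using (here; there; index)
open import Data.List.Relation.Unary.Any.Properties using (any⁺; any⁻; lookup-index)
open import Data.List.Relation.Unary.Unique.Propositional using (Unique)
open import Data.List.Relation.Unary.Unique.Propositional.Properties using (map⁺; ++⁺; filter⁺)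
open import Data.Nat using (ℕ; zero; suc; _≤_; _<_; z≤n; s≤s; _/_; _≤?_) renaming (_≟_ to _≟ⁿ_)
open import Data.Nat.Induction using (Acc; acc; <-wellFounded)
open import Data.Nat.Properties using (≤-trans; <⇒≱; ≰⇒>)
open import Data.Product using (Σ; ∃; ∃₂; _×_; _,_; proj₁; proj₂)
open import Data.Sum using (_⊎_; inj₁; inj₂; [_,_]′)
open import Data.Vec using ([]; _∷_; tabulate)
open import Data.Vec.Properties using (∷-injectiveʳ; lookup∘tabulate; tabulate∘lookup; tabulate-cong)
open import Function using (_∘_; _⇔_; mk⇔; Equivalence)
open import Function.Bundles using (mk↔ₛ′)
open import Relation.Nullary using (¬_; Dec; yes; no; does; contradiction; ¬?; _×-dec_; _⊎-dec_)
open import Relation.Nullary.Decidable using (dec-true)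
open import Relation.Binary.PropositionalEquality using (_≡_; _≢_; refl; sym; trans; cong; cong₂; subst; subst₂)

-- The permutations of three indices.

data Perm : Fin 3 → Fin 3 → Fin 3 → Set where
  p012 : Perm 0F 1F 2F
  p021 : Perm 0F 2F 1F
  p102 : Perm 1F 0F 2F
  p120 : Perm 1F 2F 0F
  p201 : Perm 2F 0F 1F
  p210 : Perm 2F 1F 0F

rotate : ∀ {i j k} → Perm i j k → Perm j k i
rotate p012 = p120
rotate p021 = p210
rotate p102 = p021
rotate p120 = p201
rotate p201 = p012
rotate p210 = p102

swap : ∀ {i j k} → Perm i j k → Perm i k j
swap p012 = p021
swap p021 = p012
swap p102 = p120
swap p120 = p102
swap p201 = p210
swap p210 = p201

first≢second : ∀ {i j k} → Perm i j k → i ≢ j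
first≢second p012 ()
first≢second p021 ()
first≢second p102 ()
first≢second p120 ()
first≢second p201 ()
first≢second p210 ()

second≢first : ∀ {i j k} → Perm i j k → j ≢ i
second≢first p = first≢second p ∘ sym

second≢third : ∀ {i j k} → Perm i j k → j ≢ k
second≢third = first≢second ∘ rotate

third≢second : ∀ {i j k} → Perm i j k → k ≢ j
third≢second = second≢third ∘ swap

first≢third : ∀ {i j k} → Perm i j k → i ≢ k
first≢third = first≢second ∘ swap

third≢first : ∀ {i j k} → Perm i j k → k ≢ i
third≢first = second≢first ∘ swap

complete-pair : ∀ {i j} → i ≢ j → ∃ λ k → Perm i j k
complete-pair {0F} {0F} i≢j = contradiction refl i≢j
complete-pair {0F} {1F} _   = 2F , p012
complete-pair {0F} {2F} _   = 1F , p021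
complete-pair {1F} {0F} _   = 2F , p102
complete-pair {1F} {1F} i≢j = contradiction refl i≢j
complete-pair {1F} {2F} _   = 0F , p120
complete-pair {2F} {0F} _   = 1F , p201
complete-pair {2F} {1F} _   = 0F , p210
complete-pair {2F} {2F} i≢j = contradiction refl i≢j

others : ∀ i → ∃₂ λ j k → Perm i j k
others 0F = 1F , 2F , p012
others 1F = 0F , 2F , p102
others 2F = 0F , 1F , p201

flip : ∀ {i j k} → Perm i j k → Perm j i k
flip = rotate ∘ rotate ∘ swap

-- Matching on `one-of p l` replaces an index by its role in `p`, so that an argument need not be
-- repeated for each of the six permutations.
data OneOf (i j k : Fin 3) : Fin 3 → Set where
  is-first  : OneOf i j k i
  is-second : OneOf i j k j
  is-third  : OneOf i j k k

one-of : ∀ {i j k} → Perm i j k → ∀ l → OneOf i j k l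
one-of p012 = λ { 0F → is-first ; 1F → is-second ; 2F → is-third }
one-of p021 = λ { 0F → is-first ; 2F → is-second ; 1F → is-third }
one-of p102 = λ { 1F → is-first ; 0F → is-second ; 2F → is-third }
one-of p120 = λ { 1F → is-first ; 2F → is-second ; 0F → is-third }
one-of p201 = λ { 2F → is-first ; 0F → is-second ; 1F → is-third }
one-of p210 = λ { 2F → is-first ; 1F → is-second ; 0F → is-third }

perm : ∀ {i j k} → i ≢ j → i ≢ k → j ≢ k → Perm i j k
perm {k = k} i≢j i≢k j≢k with complete-pair i≢j
... | l , p with one-of p k
... | is-first  = contradiction refl i≢k
... | is-second = contradiction refl j≢k
... | is-third  = p

avoid : ∀ (i j : Fin 3) → ∃ λ k → k ≢ i × k ≢ j
avoid 0F 0F = 1F , (λ ()) , (λ ())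
avoid 0F 1F = 2F , (λ ()) , (λ ())
avoid 0F 2F = 1F , (λ ()) , (λ ())
avoid 1F 0F = 2F , (λ ()) , (λ ())
avoid 1F 1F = 0F , (λ ()) , (λ ())
avoid 1F 2F = 0F , (λ ()) , (λ ())
avoid 2F 0F = 1F , (λ ()) , (λ ())
avoid 2F 1F = 0F , (λ ()) , (λ ())
avoid 2F 2F = 0F , (λ ()) , (λ ())

triple : {A : Set} → A → A → A → Fin 3 → A
triple a b c 0F = a
triple a b c 1F = b
triple a b c 2F = c

module _ {A : Set} where

  skip₂ : ∀ {a b c : A} {as} → a ∈ₗ (b ∷ as) → a ∈ₗ (b ∷ c ∷ as)
  skip₂ (here eq)  = here eq
  skip₂ (there a∈) = there (there a∈)

  skip₃ : ∀ {a b c d : A} {as} → a ∈ₗ (b ∷ c ∷ as) → a ∈ₗ (b ∷ c ∷ d ∷ as)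
  skip₃ (here eq)  = here eq
  skip₃ (there a∈) = there (skip₂ a∈)

-- Hexads, the clique graph interface and the failure of the Helly property.

-- A triangle T with three ears: E i is joined to the two vertices T j with j ≢ i but not to T i.
record Hexad {V : Set} (_~_ : V → V → Set) : Set where
  field
    T E : Fin 3 → V
    TT  : ∀ i j → T i ~ T j
    ET  : ∀ {i j} → i ≢ j → E i ~ T j
    E≁T : ∀ i → ¬ (E i ~ T i)

-- _~_ is reflexive adjacency, W the set of cliques of (V , _~_) and _≈_ their intersection relation.
record IsCliqueGraph {V W : Set} (_~_ : V → V → Set) (_≈_ : W → W → Set)
                     (_∈_ : V → W → Set) : Set where
  field
    ~-refl    : ∀ {v} → v ~ v
    ~-sym     : ∀ {u v} → u ~ v → v ~ u
    complete  : ∀ {u v i} → u ∈ i → v ∈ i → u ~ v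
    dichotomy : ∀ v i → v ∈ i ⊎ ∃ λ u → u ∈ i × ¬ (u ~ v)
    nonempty  : ∀ i → ∃ (_∈ i)
    elements  : ∀ i → ∃ λ L → ∀ v → v ∈ₗ L ⇔ v ∈ i
    extend    : ∀ u L → (∀ {v w} → v ∈ₗ (u ∷ L) → w ∈ₗ (u ∷ L) → v ~ w) →
                ∃ λ i → ∀ {v} → v ∈ₗ (u ∷ L) → v ∈ i
    ≈⇒common  : ∀ {i j} → i ≈ j → ∃ λ v → v ∈ i × v ∈ j
    common⇒≈  : ∀ {i j v} → v ∈ i → v ∈ j → i ≈ j
    antichain : ∀ {i j} → (∀ {v} → v ∈ i → v ∈ j) → i ≡ j

  maximal : ∀ {v i} → (∀ {u} → u ∈ i → u ~ v) → v ∈ i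
  maximal {v} {i} adjacent with dichotomy v i
  ... | inj₁ v∈i             = v∈i
  ... | inj₂ (u , u∈i , u≁v) = contradiction (adjacent u∈i) u≁v

  ≢-by : ∀ {u v w} → w ~ u → ¬ (w ~ v) → u ≢ v
  ≢-by w~u w≁v refl = w≁v w~u

  -- With a repeated vertex this also serves as the clique through an edge.
  clique₃ : ∀ {u v w} → u ~ v → v ~ w → u ~ w → ∃ λ i → u ∈ i × v ∈ i × w ∈ i
  clique₃ {u} {v} {w} u~v v~w u~w with extend u (v ∷ w ∷ []) pairwise
    where
    pairwise : ∀ {s t} → s ∈ₗ (u ∷ v ∷ w ∷ []) → t ∈ₗ (u ∷ v ∷ w ∷ []) → s ~ t
    pairwise (here refl)                 (here refl)                 = ~-refl
    pairwise (here refl)                 (there (here refl))         = u~v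
    pairwise (here refl)                 (there (there (here refl))) = u~w
    pairwise (there (here refl))         (here refl)                 = ~-sym u~v
    pairwise (there (here refl))         (there (here refl))         = ~-refl
    pairwise (there (here refl))         (there (there (here refl))) = v~w
    pairwise (there (there (here refl))) (here refl)                 = ~-sym u~w
    pairwise (there (there (here refl))) (there (here refl))         = ~-sym v~w
    pairwise (there (there (here refl))) (there (there (here refl))) = ~-refl
  ... | i , sub = i , sub (here refl) , sub (there (here refl)) , sub (there (there (here refl)))

  -- The cliques `F i` are kept along with the hexad because a clique that meets all three of them
  -- will be forced to contain two vertices of the triangle.
  record Obstruction (L : List W) : Set where
    field
      hexad : Hexad _~_
    open Hexad hexad public
    field
      F    : Fin 3 → W
      F∈L  : ∀ i → F i ∈ₗ L
      T∈F  : ∀ {i j} → i ≢ j → T j ∈ F i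
      E∈F  : ∀ i → E i ∈ F i

  obstruction-⊆ : ∀ {L M} → (∀ {i} → i ∈ₗ L → i ∈ₗ M) → Obstruction L → Obstruction M
  obstruction-⊆ L⊆M o = record { Obstruction o ; F∈L = λ i → L⊆M (Obstruction.F∈L o i) }

  Common : List W → Set
  Common L = ∃ λ v → ∀ {i} → i ∈ₗ L → v ∈ i

  -- If a, b, c are common to all members but F, G, H respectively, then either one of them is common
  -- to all members or they span a triangle whose ears lie in F, G, H.
  helly : ∀ n F L → length L ≡ n → (∀ {i j} → i ∈ₗ (F ∷ L) → j ∈ₗ (F ∷ L) → i ≈ j) →
          Common (F ∷ L) ⊎ Obstruction (F ∷ L)
  helly n F [] eq meet with nonempty F
  ... | v , v∈F = inj₁ (v , λ { (here refl) → v∈F })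
  helly n F (G ∷ []) eq meet with ≈⇒common (meet (here refl) (there (here refl)))
  ... | v , v∈F , v∈G = inj₁ (v , λ { (here refl) → v∈F ; (there (here refl)) → v∈G })
  helly (suc n) F (G ∷ H ∷ L) refl meet
    -- The three calls omit `F`, `G` and `H` in turn. As `G ∷ L` is no subterm of `G ∷ H ∷ L`, the
    -- recursion descends on the length `n`.
    with helly n G (H ∷ L) refl (λ i∈ j∈ → meet (there i∈) (there j∈))
       | helly n F (H ∷ L) refl (λ i∈ j∈ → meet (skip₂ i∈) (skip₂ j∈))
       | helly n F (G ∷ L) refl (λ i∈ j∈ → meet (skip₃ i∈) (skip₃ j∈))
  ... | inj₂ o | _ | _ = inj₂ (obstruction-⊆ there o)
  ... | inj₁ _ | inj₂ o | _ = inj₂ (obstruction-⊆ skip₂ o)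
  ... | inj₁ _ | inj₁ _ | inj₂ o = inj₂ (obstruction-⊆ skip₃ o)
  ... | inj₁ (a , a∈) | inj₁ (b , b∈) | inj₁ (c , c∈) with dichotomy a F | dichotomy b G | dichotomy c H
  ... | inj₁ a∈F | _ | _ = inj₁ (a , λ { (here refl) → a∈F ; (there i∈) → a∈ i∈ })
  ... | inj₂ _ | inj₁ b∈G | _ = inj₁ (b , λ { (here refl) → b∈ (here refl) ; (there (here refl)) → b∈G
                                           ; (there (there i∈)) → b∈ (there i∈) })
  ... | inj₂ _ | inj₂ _ | inj₁ c∈H = inj₁ (c , λ { (here refl) → c∈ (here refl) ; (there (here refl)) → c∈ (there (here refl))
                                           ; (there (there (here refl))) → c∈H
                                           ; (there (there (there i∈))) → c∈ (there (there i∈)) })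
  ... | inj₂ (x , x∈F , x≁a) | inj₂ (y , y∈G , y≁b) | inj₂ (z , z∈H , z≁c) = inj₂ record
    { hexad = record
      { T = T ; E = E
      ; TT = λ { 0F 0F → ~-refl ; 0F 1F → a~b ; 0F 2F → a~c
               ; 1F 0F → ~-sym a~b ; 1F 1F → ~-refl ; 1F 2F → b~c
               ; 2F 0F → ~-sym a~c ; 2F 1F → ~-sym b~c ; 2F 2F → ~-refl }
      ; ET = λ {i} i≢j → complete (E∈F i) (T∈F i≢j)
      ; E≁T = λ { 0F → x≁a ; 1F → y≁b ; 2F → z≁c } }
    ; F = Fs
    ; F∈L = λ { 0F → here refl ; 1F → there (here refl) ; 2F → there (there (here refl)) }
    ; T∈F = T∈F
    ; E∈F = E∈F }
    where
    T E : Fin 3 → _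
    T = triple a b c
    E = triple x y z
    Fs = triple F G H
    a∈G = a∈ (here refl)
    a∈H = a∈ (there (here refl))
    b∈F = b∈ (here refl)
    b∈H = b∈ (there (here refl))
    c∈F = c∈ (here refl)
    c∈G = c∈ (there (here refl))
    a~b = complete a∈H b∈H
    a~c = complete a∈G c∈G
    b~c = complete b∈F c∈F
    T∈F : ∀ {i j} → i ≢ j → T j ∈ Fs i
    T∈F {0F} {0F} i≢j = contradiction refl i≢j
    T∈F {0F} {1F} _ = b∈F
    T∈F {0F} {2F} _ = c∈F
    T∈F {1F} {0F} _ = a∈G
    T∈F {1F} {1F} i≢j = contradiction refl i≢j
    T∈F {1F} {2F} _ = c∈G
    T∈F {2F} {0F} _ = a∈H
    T∈F {2F} {1F} _ = b∈H
    T∈F {2F} {2F} i≢j = contradiction refl i≢j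
    E∈F : ∀ i → E i ∈ Fs i
    E∈F 0F = x∈F
    E∈F 1F = y∈G
    E∈F 2F = z∈H

-- The clique-Helly property and its inheritance.

module Helly {V W X : Set} {_~_ : V → V → Set} {_≈_ : W → W → Set} {_≋_ : X → X → Set}
             {_∈_ : V → W → Set} {_∈′_ : W → X → Set}
             (C : IsCliqueGraph _~_ _≈_ _∈_) (D : IsCliqueGraph _≈_ _≋_ _∈′_) where
  private
    module C = IsCliqueGraph C
    module D = IsCliqueGraph D

  -- Every pairwise intersecting family of cliques extends to a maximal one, so it is enough to ask
  -- for a common vertex of each vertex `Q` of the next clique graph.
  IsHelly : Set
  IsHelly = ∀ Q → ∃ λ v → ∀ {i} → i ∈′ Q → v ∈ i

  common-or-obstruction : ∀ Q → (∃ λ v → ∀ {i} → i ∈′ Q → v ∈ i) ⊎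
    (Σ (List W) λ L → (∀ {i} → i ∈ₗ L → i ∈′ Q) × C.Obstruction L)
  common-or-obstruction Q with D.elements Q | D.nonempty Q
  ... | [] , spec | i , i∈Q = contradiction (Equivalence.from (spec i) i∈Q) λ ()
  ... | F ∷ L′ , spec | _ with C.helly (length L′) F L′ refl
                          (λ i∈ j∈ → D.complete (Equivalence.to (spec _) i∈) (Equivalence.to (spec _) j∈))
  ... | inj₁ (v , v∈) = inj₁ (v , λ i∈Q → v∈ (Equivalence.from (spec _) i∈Q))
  ... | inj₂ o = inj₂ (F ∷ L′ , (λ {i} → Equivalence.to (spec i)) , o)

  hexad-free⇒Helly : ¬ Hexad _~_ → IsHelly
  hexad-free⇒Helly ¬hexad Q with common-or-obstruction Q
  ... | inj₁ common      = common
  ... | inj₂ (_ , _ , o) = contradiction (C.Obstruction.hexad o) ¬hexad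

  -- A clique through `v` meets each member of `Q` in `v`, so maximality of `Q` puts it into `Q`.
  common⇒star : ∀ {Q v} → (∀ {i} → i ∈′ Q → v ∈ i) → ∀ {i} → v ∈ i → i ∈′ Q
  common⇒star v∈ v∈i = D.maximal λ j∈Q → C.common⇒≈ (v∈ j∈Q) v∈i

  module _ (helly : IsHelly) where

    centre : X → V
    centre Q = proj₁ (helly Q)

    centre∈ : ∀ Q {i} → i ∈′ Q → centre Q ∈ i
    centre∈ Q = proj₂ (helly Q)

    ∈centre : ∀ Q {i} → centre Q ∈ i → i ∈′ Q
    ∈centre Q = common⇒star (centre∈ Q)

    centre-injective : ∀ {Q R} → centre Q ≡ centre R → Q ≡ R
    centre-injective {Q} {R} eq =
      D.antichain λ i∈Q → ∈centre R (subst (_∈ _) eq (centre∈ Q i∈Q))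

    centre-adjacent : ∀ {Q R} → Q ≋ R → centre Q ~ centre R
    centre-adjacent {Q} {R} Q≋R with D.≈⇒common Q≋R
    ... | i , i∈Q , i∈R = C.complete (centre∈ Q i∈Q) (centre∈ R i∈R)

    adjacent-centre : ∀ {Q R} → centre Q ~ centre R → Q ≋ R
    adjacent-centre {Q} {R} adj with C.clique₃ adj C.~-refl adj
    ... | i , q∈i , r∈i , _ = D.common⇒≈ (∈centre Q q∈i) (∈centre R r∈i)

    -- The centres of the members of `P` are pairwise adjacent and so lie in a common clique `i`.
    -- Each member is the full star of its centre and therefore contains `i`.
    Helly⇒Helly-K : {Y : Set} {_≋′_ : Y → Y → Set} {_∈″_ : X → Y → Set} →
                    IsCliqueGraph _≋_ _≋′_ _∈″_ → ∀ (P : Y) → ∃ λ i → ∀ {Q} → Q ∈″ P → i ∈′ Q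
    Helly⇒Helly-K {_∈″_ = _∈″_} B P with IsCliqueGraph.elements B P | IsCliqueGraph.nonempty B P
    ... | L , spec | Q₀ , Q₀∈P with C.extend (centre Q₀) (map centre L) pairwise
      where
      centres : ∀ {v} → v ∈ₗ (centre Q₀ ∷ map centre L) → ∃ λ Q → Q ∈″ P × v ≡ centre Q
      centres (here refl) = Q₀ , Q₀∈P , refl
      centres (there v∈) with ∈-map⁻ centre v∈
      ... | Q , Q∈L , refl = Q , Equivalence.to (spec Q) Q∈L , refl
      pairwise : ∀ {v w} → v ∈ₗ (centre Q₀ ∷ map centre L) → w ∈ₗ (centre Q₀ ∷ map centre L) → v ~ w
      pairwise v∈ w∈ with centres v∈ | centres w∈
      ... | Q , Q∈P , refl | R , R∈P , refl = centre-adjacent (IsCliqueGraph.complete B Q∈P R∈P)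
    ... | i , sub = i , λ {Q} Q∈P → ∈centre Q (sub (there (∈-map⁺ centre (Equivalence.from (spec Q) Q∈P))))

-- Closed neighbourhoods of the triangle of a hexad.

module Saturation {V W : Set} {_~_ : V → V → Set} {_≈_ : W → W → Set} {_∈_ : V → W → Set}
                  (C : IsCliqueGraph _~_ _≈_ _∈_)
                  (_≟ⱽ_ : ∀ (u v : V) → Dec (u ≡ v))
                  -- The bound is 5 because `_~_` is reflexive: `L` may contain `v` itself.
                  (degree≤4 : ∀ v {L} → Unique L → All (v ~_) L → length L ≤ 5)
                  where
  private
    module C = IsCliqueGraph C
  open Hexad

  Hex : Set
  Hex = Hexad _~_

  T≢T : ∀ (h : Hex) {i j} → i ≢ j → T h i ≢ T h j
  T≢T h i≢j = C.≢-by (ET h (i≢j ∘ sym)) (E≁T h _)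

  E≢T : ∀ (h : Hex) i j → E h i ≢ T h j
  E≢T h i j eq = E≁T h i (subst (_~ T h i) (sym eq) (TT h j i))

  E≢E : ∀ (h : Hex) {i j} → i ≢ j → E h i ≢ E h j
  E≢E h {i} {j} i≢j eq = E≁T h j (subst (_~ T h j) eq (ET h i≢j))

  data Near (h : Hex) (i : Fin 3) (v : V) : Set where
    at-T : ∀ j → v ≡ T h j → Near h i v
    at-E : ∀ j → j ≢ i → v ≡ E h j → Near h i v

  -- T i already has the four neighbours T j, T k, E j, E k.
  near : ∀ (h : Hex) {i v} → v ~ T h i → Near h i v
  near h {i} {v} v~Ti with others i
  ... | j , k , p with v ≟ⱽ T h i | v ≟ⱽ T h j | v ≟ⱽ T h k | v ≟ⱽ E h j | v ≟ⱽ E h k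
  ... | yes eq | _ | _ | _ | _ = at-T i eq
  ... | no _ | yes eq | _ | _ | _ = at-T j eq
  ... | no _ | no _ | yes eq | _ | _ = at-T k eq
  ... | no _ | no _ | no _ | yes eq | _ = at-E j (second≢first p) eq
  ... | no _ | no _ | no _ | no _ | yes eq = at-E k (third≢first p) eq
  ... | no v≢Ti | no v≢Tj | no v≢Tk | no v≢Ej | no v≢Ek = contradiction
    (degree≤4 (T h i)
      ((v≢Ti ∷ v≢Tj ∷ v≢Tk ∷ v≢Ej ∷ v≢Ek ∷ []) ∷
       (T≢T h (first≢second p) ∷ T≢T h (first≢third p) ∷ T≢E i j ∷ T≢E i k ∷ []) ∷
       (T≢T h (second≢third p) ∷ T≢E j j ∷ T≢E j k ∷ []) ∷
       (T≢E k j ∷ T≢E k k ∷ []) ∷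
       (E≢E h (second≢third p) ∷ []) ∷ [] ∷ [])
      (C.~-sym v~Ti ∷ TT h i i ∷ TT h i j ∷ TT h i k ∷
       C.~-sym (ET h (second≢first p)) ∷ C.~-sym (ET h (third≢first p)) ∷ []))
    λ { (s≤s (s≤s (s≤s (s≤s (s≤s ()))))) }
    where
    T≢E : ∀ a b → T h a ≢ E h b
    T≢E a b = E≢T h b a ∘ sym

-- The vertices linked to a hexad.

module LowDegree {V W X : Set} {_~_ : V → V → Set} {_≈_ : W → W → Set} {_≋_ : X → X → Set}
                 {_∈_ : V → W → Set} {_∈′_ : W → X → Set}
                 (C : IsCliqueGraph _~_ _≈_ _∈_) (D : IsCliqueGraph _≈_ _≋_ _∈′_)
                 (_≟ⱽ_ : ∀ (u v : V) → Dec (u ≡ v)) (_~?_ : ∀ u v → Dec (u ~ v))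
                 (degree≤4 : ∀ v {L} → Unique L → All (v ~_) L → length L ≤ 5)
                 (no-octahedron : ∀ (h : Hexad _~_) → ¬ (∀ i j → Hexad.E h i ~ Hexad.E h j))
                 where
  private
    module C = IsCliqueGraph C
    module D = IsCliqueGraph D
  open Helly C D
  open Saturation C _≟ⱽ_ degree≤4
  open Hexad

  -- This will be the criterion for adjacency in the second clique graph between the set of cliques
  -- through `v` and the set of cliques with two vertices in the triangle of `h`. By `near`, only
  -- the six vertices of `h` satisfy it.
  Link : Hex → V → Set
  Link h v = ∃ λ l → ∀ {m} → l ≢ m → v ~ T h m

  Link-T : ∀ (h : Hex) i → Link h (T h i)
  Link-T h i = i , λ {m} _ → TT h i m

  Link-E : ∀ (h : Hex) i → Link h (E h i)
  Link-E h i = i , ET h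

  near⇒Link : ∀ (h : Hex) {i v} → v ~ T h i → Link h v
  near⇒Link h v~Ti with near h v~Ti
  ... | at-T j refl = Link-T h j
  ... | at-E j _ refl = Link-E h j

  data Inside (h : Hex) (v : V) : Set where
    at-T : ∀ j → v ≡ T h j → Inside h v
    at-E : ∀ j → v ≡ E h j → Inside h v

  inside : ∀ (h : Hex) {v} → Link h v → Inside h v
  inside h (l , link) with others l
  ... | j , _ , p with near h (link (first≢second p))
  ... | at-T m eq = at-T m eq
  ... | at-E m _ eq = at-E m eq

  mkHexad : ∀ {a b c x y z} → a ~ b → b ~ c → a ~ c → x ~ b → x ~ c → y ~ a → y ~ c →
            z ~ a → z ~ b → ¬ x ~ a → ¬ y ~ b → ¬ z ~ c → Hex
  mkHexad {a} {b} {c} {x} {y} {z} ab bc ac xb xc ya yc za zb x≁a y≁b z≁c = record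
    { T = triple a b c ; E = triple x y z
    ; TT = λ { 0F 0F → C.~-refl ; 0F 1F → ab ; 0F 2F → ac
             ; 1F 0F → C.~-sym ab ; 1F 1F → C.~-refl ; 1F 2F → bc
             ; 2F 0F → C.~-sym ac ; 2F 1F → C.~-sym bc ; 2F 2F → C.~-refl }
    ; ET = λ { {0F} {0F} i≢j → contradiction refl i≢j ; {0F} {1F} _ → xb ; {0F} {2F} _ → xc
             ; {1F} {0F} _ → ya ; {1F} {1F} i≢j → contradiction refl i≢j ; {1F} {2F} _ → yc
             ; {2F} {0F} _ → za ; {2F} {1F} _ → zb ; {2F} {2F} i≢j → contradiction refl i≢j }
    ; E≁T = λ { 0F → x≁a ; 1F → y≁b ; 2F → z≁c } }

  -- The property of v that holds if the set of cliques through v is a maximal intersecting family.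
  Essential : V → Set
  Essential v = ∀ (h : Hex) {i j k} → Perm i j k → T h i ≡ v → E h j ~ E h k

  -- If `r` misses `T h i`, then `E h j`, `T h i`, `E h k` form the triangle of a new hexad with
  -- ears `T h j`, `r`, `T h k`. Essentiality of `E h j` there makes `r` adjacent to `T h k`, and
  -- `near` applies.
  ears-link : ∀ (h : Hex) {i j k r} → Perm i j k → Essential (E h j) → E h j ~ E h k →
              r ~ E h j → r ~ E h k → Link h r
  ears-link h {i} {j} {k} {r} p ess Ej~Ek r~Ej r~Ek with r ~? T h i
  ... | yes r~Ti = near⇒Link h r~Ti
  ... | no r≁Ti = near⇒Link h (ess hexad′ p012 refl)
    where
    hexad′ : Hex
    hexad′ = mkHexad {E h j} {T h i} {E h k} {T h j} {r} {T h k}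
      (ET h (second≢first p)) (C.~-sym (ET h (third≢first p))) Ej~Ek
      (TT h j i) (C.~-sym (ET h (third≢second p)))
      r~Ej r~Ek
      (C.~-sym (ET h (second≢third p))) (TT h k i)
      (E≁T h j ∘ C.~-sym) r≁Ti (E≁T h k ∘ C.~-sym)

  -- A triangle vertex among `u`, `v` settles the claim through `near`; two adjacent ears are the
  -- case of `ears-link`.
  link-closed : ∀ (h : Hex) {u v r} → Link h u → Link h v → u ≢ v → u ~ v → Essential u →
                r ~ u → r ~ v → Link h r
  link-closed h u∈ v∈ u≢v u~v ess r~u r~v with inside h u∈ | inside h v∈
  ... | at-T i refl | _ = near⇒Link h r~u
  ... | at-E _ _ | at-T i refl = near⇒Link h r~v
  ... | at-E j refl | at-E k refl with complete-pair (u≢v ∘ cong (E h))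
  ... | i , p = ears-link h (rotate (rotate p)) ess u~v r~u r~v

  -- Cliques with two vertices in the triangle of a hexad.

  Star : Hex → W → Set
  Star h w = ∃ λ l → ∀ {m} → l ≢ m → T h m ∈ w

  star : ∀ (h : Hex) {w i j} → i ≢ j → T h i ∈ w → T h j ∈ w → Star h w
  star h i≢j Ti∈w Tj∈w with complete-pair i≢j
  ... | k , p = k , λ {m} k≢m → go (one-of p m) k≢m
    where
    go : ∀ {m} → OneOf _ _ k m → k ≢ m → T h m ∈ _
    go is-first  _   = Ti∈w
    go is-second _   = Tj∈w
    go is-third  k≢k = contradiction refl k≢k

  star-star : ∀ (h : Hex) {w w′} → Star h w → Star h w′ → w ≈ w′
  star-star h (l , ∈w) (l′ , ∈w′) with avoid l l′
  ... | m , m≢l , m≢l′ = C.common⇒≈ (∈w (m≢l ∘ sym)) (∈w′ (m≢l′ ∘ sym))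

  Meet : Hex → Hex → Set
  Meet h h′ = ∃ λ w → Star h w × Star h′ w

  Meet-sym : ∀ {h h′ : Hex} → Meet h h′ → Meet h′ h
  Meet-sym (w , s , s′) = w , s′ , s

  -- A second vertex of the triangle of `h′` is a neighbour of `T h i`. If it is some `T h j`, the
  -- triangles share an edge; if it is an ear `E h j`, the clique through `T h i`, `T h k` and
  -- `E h j` belongs to both hexads.
  shared-vertex⇒Meet : ∀ (h h′ : Hex) {i l} → T h i ≡ T h′ l → Meet h h′
  shared-vertex⇒Meet h h′ {i} {l} eq with others l
  ... | m , n , q with near h {i} (subst (T h′ m ~_) (sym eq) (TT h′ m l))
  ... | at-T j eqₘ with C.clique₃ (TT h i j) C.~-refl (TT h i j)
  ... | w , Ti∈w , Tj∈w , _ = w , star h i≢j Ti∈w Tj∈w ,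
          star h′ (first≢second q) (subst (_∈ w) eq Ti∈w) (subst (_∈ w) (sym eqₘ) Tj∈w)
    where
    i≢j : i ≢ j
    i≢j refl = T≢T h′ (first≢second q) (trans (sym eq) (sym eqₘ))
  shared-vertex⇒Meet h h′ {i} {l} eq | m , n , q | at-E j j≢i eqₘ with complete-pair j≢i
  ... | k , p with C.clique₃ (TT h i k) (C.~-sym (ET h (first≢third p))) (C.~-sym (ET h j≢i))
  ... | w , Ti∈w , Tk∈w , Ej∈w = w , star h (second≢third p) Ti∈w Tk∈w ,
          star h′ (first≢second q) (subst (_∈ w) eq Ti∈w) (subst (_∈ w) (sym eqₘ) Ej∈w)

  ears-not-complete : ∀ (h : Hex) {i j k} → Perm i j k → E h i ~ E h j → E h i ~ E h k → E h j ~ E h k → ⊥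
  ears-not-complete h {i} {j} {k} p ij ik jk = no-octahedron h λ a b → go (one-of p a) (one-of p b)
    where
    go : ∀ {a b} → OneOf i j k a → OneOf i j k b → E h a ~ E h b
    go is-first  is-first  = C.~-refl
    go is-first  is-second = ij
    go is-first  is-third  = ik
    go is-second is-first  = C.~-sym ij
    go is-second is-second = C.~-refl
    go is-second is-third  = jk
    go is-third  is-first  = C.~-sym ik
    go is-third  is-second = C.~-sym jk
    go is-third  is-third  = C.~-refl

  -- Without a shared triangle vertex, `T h i` is an ear of `h′` and two vertices of the triangle of
  -- `h′` are the ears `E h j`, `E h k`. Saturation then makes the third one `E h i`, so the ears of
  -- `h` are pairwise adjacent, which is excluded.
  link⇒Meet : ∀ (h h′ : Hex) {i} → Link h′ (T h i) → Meet h h′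
  link⇒Meet h h′ {i} link with inside h′ link
  ... | at-T l eq = shared-vertex⇒Meet h h′ eq
  ... | at-E l eq with others l
  ... | m , n , q with near h {i} (subst (T h′ m ~_) (sym eq) (C.~-sym (ET h′ (first≢second q))))
                     | near h {i} (subst (T h′ n ~_) (sym eq) (C.~-sym (ET h′ (first≢third q))))
  ... | at-T j eqₘ | _ = shared-vertex⇒Meet h h′ (sym eqₘ)
  ... | at-E _ _ _ | at-T j eqₙ = shared-vertex⇒Meet h h′ (sym eqₙ)
  ... | at-E j j≢i eqₘ | at-E k k≢i eqₙ = ⊥-elim (last-ear (near h l~k))
    where
    j≢k : j ≢ k
    j≢k refl = T≢T h′ (second≢third q) (trans eqₘ (sym eqₙ))
    p : Perm i j k
    p = perm (j≢i ∘ sym) (k≢i ∘ sym) j≢k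
    -- T k is a neighbour of E j = T′ m, whose neighbourhood is saturated by h′.
    l~k : T h′ l ~ T h k
    l~k with near h′ {m} (subst (T h k ~_) (sym eqₘ) (C.~-sym (ET h j≢k)))
    ... | at-T o e with one-of q o
    ...   | is-first  = ⊥-elim (E≁T h′ l (subst₂ _~_ eq e (TT h i k)))
    ...   | is-second = ⊥-elim (E≢T h j k (trans (sym eqₘ) (sym e)))
    ...   | is-third  = ⊥-elim (E≢T h k k (trans (sym eqₙ) (sym e)))
    l~k | at-E o o≢m e with one-of q o
    ...   | is-first  = ⊥-elim (T≢T h k≢i (trans e (sym eq)))
    ...   | is-second = contradiction refl o≢m
    ...   | is-third  = subst (T h′ l ~_) (sym e) (C.~-sym (ET h′ (third≢first q)))
    last-ear : Near h k (T h′ l) → ⊥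
    last-ear (at-T o e) = E≁T h′ l (subst₂ _~_ eq (sym e) (TT h i o))
    last-ear (at-E o o≢k e) with one-of p o
    ... | is-first  = ears-not-complete h p (subst₂ _~_ e eqₘ (TT h′ l m)) (subst₂ _~_ e eqₙ (TT h′ l n))
                                            (subst₂ _~_ eqₘ eqₙ (TT h′ m n))
    ... | is-second = T≢T h′ (first≢second q) (trans e (sym eqₘ))
    ... | is-third  = contradiction refl o≢k

  -- If `u` or `v` is a triangle vertex of one hexad, `link⇒Meet` applies. Otherwise both are ears
  -- of `h′`, some triangle vertex of `h′` is adjacent to both, and `link-closed` links it to `h`.
  common-links⇒Meet : ∀ (h h′ : Hex) {u v} → Link h u → Link h v → Link h′ u → Link h′ v →
                      u ≢ v → u ~ v → Essential u → Meet h h′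
  common-links⇒Meet h h′ hu hv h′u h′v u≢v u~v ess
    with inside h hu | inside h hv | inside h′ h′u | inside h′ h′v
  ... | at-T _ refl | _ | _ | _ = link⇒Meet h h′ h′u
  ... | at-E _ _ | at-T _ refl | _ | _ = link⇒Meet h h′ h′v
  ... | at-E _ _ | at-E _ _ | at-T _ refl | _ = Meet-sym {h′} {h} (link⇒Meet h′ h hu)
  ... | at-E _ _ | at-E _ _ | at-E _ _ | at-T _ refl = Meet-sym {h′} {h} (link⇒Meet h′ h hv)
  ... | at-E _ _ | at-E _ _ | at-E m u≡ | at-E n v≡ with avoid m n
  ... | l , l≢m , l≢n = Meet-sym {h′} {h} (link⇒Meet h′ h (link-closed h hu hv u≢v u~v ess
          (subst (T h′ l ~_) (sym u≡) (C.~-sym (ET h′ (l≢m ∘ sym))))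
          (subst (T h′ l ~_) (sym v≡) (C.~-sym (ET h′ (l≢n ∘ sym))))))

  -- In the common clique, both `T h′ m` and `T h′ n` are adjacent to `T h j` and `T h k`. Hence
  -- each lies in the triangle of `h` or equals `E h i`, and they cannot both equal `E h i`.
  Meet⇒shared-vertex : ∀ (h h′ : Hex) → Meet h h′ → ∃₂ λ i l → T h i ≡ T h′ l
  Meet⇒shared-vertex h h′ (w , (i , T∈w) , (l , T′∈w)) with others i | others l
  ... | j , k , p | m , n , q = conclude (locate (first≢second q)) (locate (first≢third q))
    where
    locate : ∀ {o} → l ≢ o → (∃ λ a → T h a ≡ T h′ o) ⊎ T h′ o ≡ E h i
    locate l≢o with near h (C.complete (T′∈w l≢o) (T∈w (first≢second p)))
    ... | at-T a eq = inj₁ (a , sym eq)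
    ... | at-E a a≢j eq with one-of p a
    ...   | is-first  = inj₂ eq
    ...   | is-second = contradiction refl a≢j
    ...   | is-third  = ⊥-elim (E≁T h k (subst (_~ T h k) eq (C.complete (T′∈w l≢o) (T∈w (first≢third p)))))
    conclude : (∃ λ a → T h a ≡ T h′ m) ⊎ T h′ m ≡ E h i → (∃ λ a → T h a ≡ T h′ n) ⊎ T h′ n ≡ E h i →
               ∃₂ λ i l → T h i ≡ T h′ l
    conclude (inj₁ (a , eq)) _ = a , m , eq
    conclude (inj₂ _) (inj₁ (a , eq)) = a , n , eq
    conclude (inj₂ eqₘ) (inj₂ eqₙ) = ⊥-elim (T≢T h′ (second≢third q) (trans eqₘ (sym eqₙ)))

  -- Relative positions of two hexads.

  _⊑_ : Hex → Hex → Set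
  h ⊑ h′ = ∀ l → ∃ λ i → T h l ≡ T h′ i

  -- Two triangles of hexads in a common clique coincide, share an edge, or share only a vertex T i
  -- whose four neighbours form a cycle.
  data Position (h h′ : Hex) : Set where
    same  : h′ ⊑ h → Position h h′
    edge  : ∀ {i j k l m n} → Perm i j k → Perm l m n →
            T h′ l ≡ T h i → T h′ m ≡ T h j → T h′ n ≡ E h k → Position h h′
    wheel : ∀ {i j k l m n} → Perm i j k → Perm l m n →
            T h′ l ≡ T h i → T h′ m ≡ E h j → T h′ n ≡ E h k → Position h h′

  -- Around a shared vertex, `near` locates the other two vertices of the triangle of `h′`; the
  -- cases differ in how many of them are ears of `h`.
  position : ∀ (h h′ : Hex) → Meet h h′ → Position h h′
  position h h′ meet with Meet⇒shared-vertex h h′ meet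
  ... | i , l , eq with others l
  ... | m , n , q with near h {i} (subst (T h′ m ~_) (sym eq) (TT h′ m l))
                     | near h {i} (subst (T h′ n ~_) (sym eq) (TT h′ n l))
  ... | at-T a eqₘ | at-T b eqₙ = same λ o → go (one-of q o)
    where
    go : ∀ {o} → OneOf l m n o → ∃ λ i → T h′ o ≡ T h i
    go is-first  = i , sym eq
    go is-second = a , eqₘ
    go is-third  = b , eqₙ
  ... | at-T a eqₘ | at-E b b≢i eqₙ = edge (perm i≢a (b≢i ∘ sym) a≢b) q (sym eq) eqₘ eqₙ
    where
    i≢a : i ≢ a
    i≢a refl = T≢T h′ (first≢second q) (trans (sym eq) (sym eqₘ))
    a≢b : a ≢ b
    a≢b refl = E≁T h a (subst₂ _~_ eqₙ eqₘ (TT h′ n m))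
  ... | at-E b b≢i eqₘ | at-T a eqₙ = edge (perm i≢a (b≢i ∘ sym) a≢b) (swap q) (sym eq) eqₙ eqₘ
    where
    i≢a : i ≢ a
    i≢a refl = T≢T h′ (first≢third q) (trans (sym eq) (sym eqₙ))
    a≢b : a ≢ b
    a≢b refl = E≁T h a (subst₂ _~_ eqₘ eqₙ (TT h′ m n))
  ... | at-E a a≢i eqₘ | at-E b b≢i eqₙ = wheel (perm (a≢i ∘ sym) (b≢i ∘ sym) a≢b) q (sym eq) eqₘ eqₙ
    where
    a≢b : a ≢ b
    a≢b refl = T≢T h′ (second≢third q) (trans eqₘ (sym eqₙ))

  -- `E h′ m` is a neighbour of `T h i`, and the incidences of `h′` rule out all the candidates
  -- given by `near` except `E h j`.
  edge-ear : ∀ (h h′ : Hex) {i j k l m n} → Perm i j k → Perm l m n →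
             T h′ l ≡ T h i → T h′ m ≡ T h j → T h′ n ≡ E h k → E h′ m ≡ E h j
  edge-ear h h′ {m = m} p q eqₗ eqₘ eqₙ with near h (subst (E h′ m ~_) eqₗ (ET h′ (second≢first q)))
  ... | at-T o e with one-of p o
  ...   | is-first  = ⊥-elim (E≢T h′ _ _ (trans e (sym eqₗ)))
  ...   | is-second = ⊥-elim (E≢T h′ _ _ (trans e (sym eqₘ)))
  ...   | is-third  = ⊥-elim (E≁T h′ m (subst₂ _~_ (sym e) (sym eqₘ) (TT h _ _)))
  edge-ear h h′ p q eqₗ eqₘ eqₙ | at-E o o≢i e with one-of p o
  ...   | is-first  = contradiction refl o≢i
  ...   | is-second = e
  ...   | is-third  = ⊥-elim (E≢T h′ _ _ (trans e (sym eqₙ)))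

  edge-ears-adjacent : ∀ (h h′ : Hex) {i j k l m n} → Perm i j k → Perm l m n →
                       T h′ l ≡ T h i → T h′ m ≡ T h j → T h′ n ≡ E h k → E h j ~ E h k
  edge-ears-adjacent h h′ p q eqₗ eqₘ eqₙ =
    subst₂ _~_ (edge-ear h h′ p q eqₗ eqₘ eqₙ) eqₙ (ET h′ (second≢third q))

  -- Two triangle vertices of `h` lie in the triangle of `h′`, the third is joined to that shared
  -- edge, and by `edge-ear` the ears of `h` are vertices of `h′` too.
  edge-Link : ∀ (h h′ : Hex) {i j k l m n} → Perm i j k → Perm l m n →
              T h′ l ≡ T h i → T h′ m ≡ T h j → T h′ n ≡ E h k → ∀ {v} → Link h v → Link h′ v
  edge-Link h h′ {i} {j} {k} {l} {m} {n} p q eqₗ eqₘ eqₙ link with inside h link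
  ... | at-T o refl with one-of p o
  ...   | is-first  = subst (Link h′) eqₗ (Link-T h′ l)
  ...   | is-second = subst (Link h′) eqₘ (Link-T h′ m)
  ...   | is-third  = n , λ n≢o → go (one-of q _) n≢o
    where
    go : ∀ {o} → OneOf l m n o → n ≢ o → T h k ~ T h′ o
    go is-first  _   = subst (T h k ~_) (sym eqₗ) (TT h k i)
    go is-second _   = subst (T h k ~_) (sym eqₘ) (TT h k j)
    go is-third  n≢n = contradiction refl n≢n
  edge-Link h h′ {l = l} {m} {n} p q eqₗ eqₘ eqₙ link | at-E o refl with one-of p o
  ...   | is-first  = subst (Link h′) (edge-ear h h′ (flip p) (flip q) eqₘ eqₗ eqₙ) (Link-E h′ l)
  ...   | is-second = subst (Link h′) (edge-ear h h′ p q eqₗ eqₘ eqₙ) (Link-E h′ m)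
  ...   | is-third  = subst (Link h′) eqₙ (Link-T h′ n)

  module Wheel (h h′ : Hex) where

    wheel-ear : ∀ {i j k l m n} → Perm i j k → Perm l m n →
                T h′ l ≡ T h i → T h′ m ≡ E h j → T h′ n ≡ E h k → E h′ n ≡ T h k
    wheel-ear {j = j} {n = n} p q eqₗ eqₘ eqₙ with near h (subst (E h′ n ~_) eqₗ (ET h′ (third≢first q)))
    ... | at-T o e with one-of p o
    ...   | is-first  = ⊥-elim (E≢T h′ _ _ (trans e (sym eqₗ)))
    ...   | is-second = ⊥-elim (E≁T h j (C.~-sym (subst₂ _~_ e eqₘ (ET h′ (third≢second q)))))
    ...   | is-third  = e
    wheel-ear p q eqₗ eqₘ eqₙ | at-E o o≢i e with one-of p o
    ...   | is-first  = contradiction refl o≢i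
    ...   | is-second = ⊥-elim (E≢T h′ _ _ (trans e (sym eqₘ)))
    ...   | is-third  = ⊥-elim (E≢T h′ _ _ (trans e (sym eqₙ)))

    -- Saturation at `T h′ m` would force `E h i` to be `E h′ l`. Then it would also be adjacent to
    -- `E h k`, and the ears of `h` would be pairwise adjacent.
    wheel-nonadjacent : ∀ {i j k l m n} → Perm i j k → Perm l m n →
                        T h′ l ≡ T h i → T h′ m ≡ E h j → T h′ n ≡ E h k → ¬ (E h i ~ E h j)
    wheel-nonadjacent {i} {l = l} {m} {n} p q eqₗ eqₘ eqₙ Ei~Ej with near h′ (subst (E h i ~_) (sym eqₘ) Ei~Ej)
    ... | at-T o e with one-of q o
    ...   | is-first  = E≢T h _ _ (trans e eqₗ)
    ...   | is-second = E≢E h (first≢second p) (trans e eqₘ)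
    ...   | is-third  = E≢E h (first≢third p) (trans e eqₙ)
    wheel-nonadjacent {i} {l = l} {m} {n} p q eqₗ eqₘ eqₙ Ei~Ej | at-E o o≢m e with one-of q o
    ...   | is-first  = ears-not-complete h p Ei~Ej (subst₂ _~_ (sym e) eqₙ (ET h′ (first≢third q)))
                          (subst₂ _~_ eqₘ eqₙ (TT h′ m n))
    ...   | is-second = contradiction refl o≢m
    ...   | is-third  = E≢T h _ _ (trans e (wheel-ear p q eqₗ eqₘ eqₙ))

    -- Essentiality, applied in `h′` to `T h′ m`, would join `E h′ l` to `E h′ n`, which is `T h k`.
    -- Saturation at `T h k` then leaves only `E h i` for `E h′ l`, contrary to `wheel-nonadjacent`.
    wheel-rim : ∀ {i j k l m n} → Perm i j k → Perm l m n →
                T h′ l ≡ T h i → T h′ m ≡ E h j → T h′ n ≡ E h k → ¬ Essential (E h j)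
    wheel-rim {i} {j} {k} {l} {m} {n} p q eqₗ eqₘ eqₙ ess
      with near h (subst (E h′ l ~_) (wheel-ear p q eqₗ eqₘ eqₙ) (ess h′ (flip q) eqₘ))
    ... | at-T o e = E≁T h′ l (subst₂ _~_ (sym e) (sym eqₗ) (TT h o i))
    ... | at-E o o≢k e with one-of p o
    ...   | is-first  = wheel-nonadjacent p q eqₗ eqₘ eqₙ (subst₂ _~_ e eqₘ (ET h′ (first≢second q)))
    ...   | is-second = E≢T h′ _ _ (trans e (sym eqₘ))
    ...   | is-third  = contradiction refl o≢k

    module _ {i j k l m n} (p : Perm i j k) (q : Perm l m n)
             (eqₗ : T h′ l ≡ T h i) (eqₘ : T h′ m ≡ E h j) (eqₙ : T h′ n ≡ E h k) where

      hub-ear-isolated : ∀ {o} → o ≢ i → ¬ (E h i ~ E h o)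
      hub-ear-isolated {o} o≢i with one-of p o
      ... | is-first  = contradiction refl o≢i
      ... | is-second = wheel-nonadjacent p q eqₗ eqₘ eqₙ
      ... | is-third  = wheel-nonadjacent (swap p) (swap q) eqₗ eqₙ eqₘ

      -- Essentiality of `T h j` or `T h k` would join `E h i` to another ear, `E h j` and `E h k`
      -- are not essential by `wheel-rim`, and `E h i` is not a vertex of `h′`.
      common-link⇒hub : ∀ {v} → Essential v → Link h v → Link h′ v → v ≡ T h i
      common-link⇒hub ess hv h′v with inside h hv
      ... | at-T o refl with one-of p o
      ...   | is-first  = refl
      ...   | is-second = ⊥-elim (hub-ear-isolated (third≢first p) (ess h (flip p) refl))
      ...   | is-third  = ⊥-elim (hub-ear-isolated (second≢first p) (ess h (rotate (rotate p)) refl))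
      common-link⇒hub ess hv h′v | at-E o refl with one-of p o
      ...   | is-second = ⊥-elim (wheel-rim p q eqₗ eqₘ eqₙ ess)
      ...   | is-third  = ⊥-elim (wheel-rim (swap p) (swap q) eqₗ eqₙ eqₘ ess)
      ...   | is-first with inside h′ h′v
      ...     | at-T o′ e with one-of q o′
      ...       | is-first  = ⊥-elim (E≢T h _ _ (trans e eqₗ))
      ...       | is-second = ⊥-elim (E≢E h (first≢second p) (trans e eqₘ))
      ...       | is-third  = ⊥-elim (E≢E h (first≢third p) (trans e eqₙ))
      common-link⇒hub ess hv h′v | at-E o refl | is-first | at-E o′ e with one-of q o′
      ...       | is-first  = ⊥-elim (hub-ear-isolated (second≢first p)
                                        (subst₂ _~_ (sym e) eqₘ (ET h′ (first≢second q))))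
      ...       | is-second = ⊥-elim (E≢T h _ _ (trans e (wheel-ear (swap p) (swap q) eqₗ eqₙ eqₘ)))
      ...       | is-third  = ⊥-elim (E≢T h _ _ (trans e (wheel-ear p q eqₗ eqₘ eqₙ)))

      -- Edge position, or a wheel with another hub, would make `E h i` adjacent to another ear of
      -- `h`. A wheel with the same hub has the triangle of `h′`.
      wheel-Meet : ∀ h″ → Meet h h″ → (h″ ⊑ h) ⊎ (h″ ⊑ h′)
      wheel-Meet h″ meet with position h h″ meet
      ... | same h″⊑h = inj₁ h″⊑h
      ... | edge p′ q′ e₁ e₂ e₃ with one-of p′ i
      ...   | is-first  = ⊥-elim (hub-ear-isolated (third≢first p′) (edge-ears-adjacent h h″ (flip p′) (flip q′) e₂ e₁ e₃))
      ...   | is-second = ⊥-elim (hub-ear-isolated (third≢second p′) (edge-ears-adjacent h h″ p′ q′ e₁ e₂ e₃))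
      ...   | is-third  = ⊥-elim (hub-ear-isolated (second≢third p′) (C.~-sym (edge-ears-adjacent h h″ p′ q′ e₁ e₂ e₃)))
      wheel-Meet h″ meet | wheel {l = l′} {m′} {n′} p′ q′ e₁ e₂ e₃ with one-of p′ i
      ...   | is-second = ⊥-elim (hub-ear-isolated (third≢second p′) (subst₂ _~_ e₂ e₃ (TT h″ m′ n′)))
      ...   | is-third  = ⊥-elim (hub-ear-isolated (second≢third p′) (subst₂ _~_ e₃ e₂ (TT h″ n′ m′)))
      ...   | is-first  = inj₂ λ o → go (one-of q′ o)
        where
        rim : ∀ {o} → o ≢ i → ∃ λ a → E h o ≡ T h′ a
        rim {o} o≢i with one-of p o
        ... | is-first  = contradiction refl o≢i
        ... | is-second = m , sym eqₘ
        ... | is-third  = n , sym eqₙ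
        go : ∀ {o} → OneOf l′ m′ n′ o → ∃ λ a → T h″ o ≡ T h′ a
        go is-first  = l , trans e₁ (sym eqₗ)
        go is-second with rim (second≢first p′)
        ... | a , e = a , trans e₂ e
        go is-third with rim (third≢first p′)
        ... | a , e = a , trans e₃ e

  ⊑⇒Star⊆ : ∀ (h h′ : Hex) → h ⊑ h′ → ∀ {w} → Star h w → Star h′ w
  ⊑⇒Star⊆ h h′ h⊑h′ {w} (l , ∈w) with others l
  ... | m , n , q with h⊑h′ m | h⊑h′ n
  ... | a , eqₘ | b , eqₙ = star h′ a≢b (subst (_∈ w) eqₘ (∈w (first≢second q))) (subst (_∈ w) eqₙ (∈w (first≢third q)))
    where
    a≢b : a ≢ b
    a≢b refl = T≢T h (second≢third q) (trans eqₘ (sym eqₙ))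

  -- The two kinds of vertices of the second clique graph.

  record IsVertex (Q : X) (v : V) : Set where
    constructor through
    field atᵛ : ∀ i → i ∈′ Q ⇔ v ∈ i
  open IsVertex

  record IsHex (Q : X) (h : Hex) : Set where
    constructor around
    field atʰ : ∀ i → i ∈′ Q ⇔ Star h i
  open IsHex

  open Equivalence using (to; from)

  data Kind (Q : X) : Set where
    vertex : ∀ v → IsVertex Q v → Kind Q
    hex    : ∀ h → IsHex Q h → Kind Q

  -- Any two pairs of vertices of a triangle overlap, so a clique in `Star h` meets every member of
  -- `Q` and belongs to `Q` by maximality.
  star⊇⇒IsHex : ∀ {Q} (h : Hex) → (∀ {i} → i ∈′ Q → Star h i) → IsHex Q h
  star⊇⇒IsHex h Q⊆ = around λ i → mk⇔ Q⊆ λ h∋i → D.maximal λ j∈Q → star-star h (Q⊆ j∈Q) h∋i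

  -- A clique meeting all the F i contains some T j, as the three ears are not pairwise adjacent;
  -- as it meets F j, it contains a second vertex of the triangle.
  obstruction⇒Star : ∀ {L w} (o : C.Obstruction L) → (∀ {i} → i ∈ₗ L → i ≈ w) →
                     Star (C.Obstruction.hexad o) w
  obstruction⇒Star {w = w} o meets = conclude (hit 0F) (hit 1F) (hit 2F)
    where
    open C.Obstruction o using (F; F∈L; T∈F; E∈F) renaming (hexad to h)
    hit : ∀ i → (∃ λ j → i ≢ j × T h j ∈ w) ⊎ E h i ∈ w
    hit i with C.≈⇒common (meets (F∈L i)) | others i
    ... | v , v∈F , v∈w | j , k , p with inside h (i , λ i≢m → C.complete v∈F (T∈F i≢m))
    ... | at-T a refl with one-of p a
    ...   | is-first  = ⊥-elim (E≁T h i (C.complete (E∈F i) v∈F))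
    ...   | is-second = inj₁ (j , first≢second p , v∈w)
    ...   | is-third  = inj₁ (k , first≢third p , v∈w)
    hit i | v , v∈F , v∈w | j , k , p | at-E a refl with one-of p a
    ...   | is-first  = inj₂ v∈w
    ...   | is-second = ⊥-elim (E≁T h j (C.complete v∈F (T∈F (first≢second p))))
    ...   | is-third  = ⊥-elim (E≁T h k (C.complete v∈F (T∈F (first≢third p))))
    second : ∀ {j} → T h j ∈ w → Star h w
    second {j} Tj∈w with hit j
    ... | inj₁ (k , j≢k , Tk∈w) = star h j≢k Tj∈w Tk∈w
    ... | inj₂ Ej∈w = ⊥-elim (E≁T h j (C.complete Ej∈w Tj∈w))
    Hit : Fin 3 → Set
    Hit i = (∃ λ j → i ≢ j × T h j ∈ w) ⊎ E h i ∈ w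
    conclude : Hit 0F → Hit 1F → Hit 2F → Star h w
    conclude (inj₁ (_ , _ , T∈w)) _ _ = second T∈w
    conclude (inj₂ _) (inj₁ (_ , _ , T∈w)) _ = second T∈w
    conclude (inj₂ _) (inj₂ _) (inj₁ (_ , _ , T∈w)) = second T∈w
    conclude (inj₂ E₀) (inj₂ E₁) (inj₂ E₂) =
      ⊥-elim (ears-not-complete h p012 (C.complete E₀ E₁) (C.complete E₀ E₂) (C.complete E₁ E₂))

  kind : ∀ Q → Kind Q
  kind Q with common-or-obstruction Q
  ... | inj₁ (v , v∈) = vertex v (through λ i → mk⇔ v∈ (common⇒star v∈))
  ... | inj₂ (L , L⊆Q , o) = hex (C.Obstruction.hexad o) (star⊇⇒IsHex _ λ i∈Q →
          obstruction⇒Star o λ j∈L → D.complete (L⊆Q j∈L) i∈Q)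

  -- If E j and E k were not adjacent, every clique through T i would contain two vertices of T.
  IsVertex⇒Essential : ∀ {Q v} → IsVertex Q v → Essential v
  IsVertex⇒Essential {Q} isV h {i} {j} {k} p refl with E h j ~? E h k
  ... | yes Ej~Ek = Ej~Ek
  -- The clique through `T h j`, `T h k` and `E h i` would then lie in `Q`, hence contain `T h i`,
  -- which is not adjacent to `E h i`.
  ... | no Ej≁Ek with C.clique₃ (TT h j k) (C.~-sym (ET h (first≢third p))) (C.~-sym (ET h (first≢second p)))
  ... | w , Tj∈w , Tk∈w , Ei∈w = ⊥-elim (E≁T h i (C.complete Ei∈w (to (atᵛ isV w)
          (from (atʰ (star⊇⇒IsHex {Q} h λ i∈Q → two (to (atᵛ isV _) i∈Q)) w) (star h (second≢third p) Tj∈w Tk∈w)))))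
    where
    other : ∀ {j k u} → Perm i j k → u ~ T h i → ¬ (u ~ T h j) → u ≡ E h j
    other {j} p u~Ti u≁Tj with near h u~Ti
    ... | at-T o refl = contradiction (TT h o j) u≁Tj
    ... | at-E o o≢i refl with one-of p o
    ...   | is-first  = contradiction refl o≢i
    ...   | is-second = refl
    ...   | is-third  = contradiction (ET h (third≢second p)) u≁Tj
    two : ∀ {w} → T h i ∈ w → Star h w
    two {w} Ti∈w with C.dichotomy (T h j) w | C.dichotomy (T h k) w
    ... | inj₁ Tj∈w | _ = star h (first≢second p) Ti∈w Tj∈w
    ... | inj₂ _ | inj₁ Tk∈w = star h (first≢third p) Ti∈w Tk∈w
    -- Neighbours of `T h i` that miss `T h j` and `T h k` respectively can only be `E h j` and
    -- `E h k`.
    ... | inj₂ (u , u∈w , u≁Tj) | inj₂ (v , v∈w , v≁Tk)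
      with other p (C.complete u∈w Ti∈w) u≁Tj | other (swap p) (C.complete v∈w Ti∈w) v≁Tk
    ... | refl | refl = contradiction (C.complete u∈w v∈w) Ej≁Ek

  ≋-sym : ∀ {Q R} → Q ≋ R → R ≋ Q
  ≋-sym Q≋R with D.≈⇒common Q≋R
  ... | i , i∈Q , i∈R = D.common⇒≈ i∈R i∈Q

  module _ {Q R : X} where

    vertices-adjacent : ∀ {u v} → IsVertex Q u → IsVertex R v → Q ≋ R → u ~ v
    vertices-adjacent isU isV Q≋R with D.≈⇒common Q≋R
    ... | i , i∈Q , i∈R = C.complete (to (atᵛ isU i) i∈Q) (to (atᵛ isV i) i∈R)

    adjacent-vertices : ∀ {u v} → IsVertex Q u → IsVertex R v → u ~ v → Q ≋ R
    adjacent-vertices isU isV u~v with C.clique₃ u~v C.~-refl u~v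
    ... | i , u∈i , v∈i , _ = D.common⇒≈ (from (atᵛ isU i) u∈i) (from (atᵛ isV i) v∈i)

    adjacent⇒Link : ∀ {v h} → IsVertex Q v → IsHex R h → Q ≋ R → Link h v
    adjacent⇒Link isV isH Q≋R with D.≈⇒common Q≋R
    ... | i , i∈Q , i∈R with to (atʰ isH i) i∈R
    ... | l , T∈i = l , λ l≢m → C.complete (to (atᵛ isV i) i∈Q) (T∈i l≢m)

    Link⇒adjacent : ∀ {v h} → IsVertex Q v → IsHex R h → Link h v → Q ≋ R
    Link⇒adjacent {v} {h} isV isH (l , v~T) with others l
    ... | m , n , p with C.clique₃ (v~T (first≢second p)) (TT h m n) (v~T (first≢third p))
    ... | i , v∈i , Tm∈i , Tn∈i = D.common⇒≈ (from (atᵛ isV i) v∈i) (from (atʰ isH i) (star h (second≢third p) Tm∈i Tn∈i))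

    adjacent⇒Meet : ∀ {h h′} → IsHex Q h → IsHex R h′ → Q ≋ R → Meet h h′
    adjacent⇒Meet isH isH′ Q≋R with D.≈⇒common Q≋R
    ... | i , i∈Q , i∈R = i , to (atʰ isH i) i∈Q , to (atʰ isH′ i) i∈R

    Meet⇒adjacent : ∀ {h h′} → IsHex Q h → IsHex R h′ → Meet h h′ → Q ≋ R
    Meet⇒adjacent isH isH′ (i , i∈h , i∈h′) = D.common⇒≈ (from (atʰ isH i) i∈h) (from (atʰ isH′ i) i∈h′)

    IsVertex-injective : ∀ {v} → IsVertex Q v → IsVertex R v → Q ≡ R
    IsVertex-injective isV isV′ = D.antichain λ i∈Q → from (atᵛ isV′ _) (to (atᵛ isV _) i∈Q)

    ⊑⇒≡ : ∀ {h h′} → IsHex Q h → IsHex R h′ → h ⊑ h′ → Q ≡ R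
    ⊑⇒≡ {h} {h′} isH isH′ h⊑h′ = D.antichain λ i∈Q → from (atʰ isH′ _) (⊑⇒Star⊆ h h′ h⊑h′ (to (atʰ isH _) i∈Q))

  -- Excluding hexads from the second clique graph.

  module _ (H : Hexad _≋_) where
    open Hexad H using () renaming (T to P; E to S; TT to PP; ET to SP; E≁T to S≁P)

    P≢P : ∀ {i j} → i ≢ j → P i ≢ P j
    P≢P {i} {j} i≢j eq = S≁P j (subst (S j ≋_) eq (SP (i≢j ∘ sym)))

    S≢P : ∀ i j → S i ≢ P j
    S≢P i j eq = S≁P i (subst (_≋ P i) (sym eq) (PP j i))

    -- In edge position every neighbour of `P i` is a neighbour of `P j`, against the choice of
    -- `S j`. In wheel position the common neighbours `P k` and `S k` both consist of the cliques
    -- through the hub, so they would be adjacent.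
    not-two-hexads : ∀ {i j k h h′} → Perm i j k → IsHex (P i) h → ¬ IsHex (P j) h′
    not-two-hexads {i} {j} {k} {h} {h′} r isH isH′ with position h h′ (adjacent⇒Meet isH isH′ (PP i j))
    ... | same h′⊑h = P≢P (second≢first r) (⊑⇒≡ isH′ isH h′⊑h)
    ... | edge p q e₁ e₂ e₃ with kind (S j)
    ...   | vertex v isV = S≁P j (Link⇒adjacent isV isH′ (edge-Link h h′ p q e₁ e₂ e₃
                             (adjacent⇒Link isV isH (SP (second≢first r)))))
    ...   | hex h″ isH″ with Meet⇒shared-vertex h″ h (adjacent⇒Meet isH″ isH (SP (second≢first r)))
    ...     | a , b , eq = S≁P j (Meet⇒adjacent isH″ isH′ (link⇒Meet h″ h′
                             (edge-Link h h′ p q e₁ e₂ e₃ (subst (Link h) (sym eq) (Link-T h b)))))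
    not-two-hexads {i} {j} {k} {h} {h′} r isH isH′ | wheel {o} p q e₁ e₂ e₃
      with hub (PP k i) (PP k j) (P≢P (third≢first r)) (P≢P (third≢second r))
         | hub (SP (third≢first r)) (SP (third≢second r)) (S≢P k i) (S≢P k j)
      where
      hub : ∀ {Q} → Q ≋ P i → Q ≋ P j → Q ≢ P i → Q ≢ P j → IsVertex Q (T h o)
      hub {Q} Q≋Pi Q≋Pj Q≢Pi Q≢Pj with kind Q
      ... | vertex v isV with Wheel.common-link⇒hub h h′ p q e₁ e₂ e₃ (IsVertex⇒Essential isV)
                                (adjacent⇒Link isV isH Q≋Pi) (adjacent⇒Link isV isH′ Q≋Pj)
      ...   | refl = isV
      hub Q≋Pi Q≋Pj Q≢Pi Q≢Pj | hex h″ isH″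
        with Wheel.wheel-Meet h h′ p q e₁ e₂ e₃ h″ (Meet-sym {h″} {h} (adjacent⇒Meet isH″ isH Q≋Pi))
      ...   | inj₁ h″⊑h  = contradiction (⊑⇒≡ isH″ isH h″⊑h) Q≢Pi
      ...   | inj₂ h″⊑h′ = contradiction (⊑⇒≡ isH″ isH′ h″⊑h′) Q≢Pj
    ... | isV | isV′ = S≁P k (adjacent-vertices isV′ isV C.~-refl)

    -- The other two triangle vertices are now given by adjacent vertices `u`, `v` linked to `h`.
    -- Their common neighbour `S i` is forced to be adjacent to `P i`, by `link-closed` or
    -- `common-links⇒Meet` according to its kind.
    P-not-hexad : ∀ {i h} → ¬ IsHex (P i) h
    P-not-hexad {i} {h} isH with others i
    ... | j , k , r with kind (P j) | kind (P k)
    ... | hex _ isH′ | _ = not-two-hexads r isH isH′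
    ... | vertex _ _ | hex _ isH′ = not-two-hexads (swap r) isH isH′
    ... | vertex u isU | vertex v isV with kind (S i)
    ...   | vertex s isS = S≁P i (Link⇒adjacent isS isH (link-closed h
              (adjacent⇒Link isU isH (PP j i)) (adjacent⇒Link isV isH (PP k i)) u≢v
              (vertices-adjacent isU isV (PP j k)) (IsVertex⇒Essential isU)
              (vertices-adjacent isS isU (SP (first≢second r))) (vertices-adjacent isS isV (SP (first≢third r)))))
      where
      u≢v : u ≢ v
      u≢v refl = P≢P (second≢third r) (IsVertex-injective isU isV)
    ...   | hex h′ isH′ = S≁P i (Meet⇒adjacent isH′ isH (Meet-sym {h} {h′} (common-links⇒Meet h h′
              (adjacent⇒Link isU isH (PP j i)) (adjacent⇒Link isV isH (PP k i))
              (adjacent⇒Link isU isH′ (≋-sym (SP (first≢second r)))) (adjacent⇒Link isV isH′ (≋-sym (SP (first≢third r))))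
              u≢v (vertices-adjacent isU isV (PP j k)) (IsVertex⇒Essential isU))))
      where
      u≢v : u ≢ v
      u≢v refl = P≢P (second≢third r) (IsVertex-injective isU isV)

    P-vertex : ∀ i → ∃ (IsVertex (P i))
    P-vertex i with kind (P i)
    ... | vertex v isV = v , isV
    ... | hex _ isH = ⊥-elim (P-not-hexad isH)

    -- If `S i` came from a hexad, the vertices of `P j` and `P k` would be linked to it, and
    -- `link-closed` would link their common neighbour, making `P i` adjacent to `S i`.
    S-vertex : ∀ i → ∃ (IsVertex (S i))
    S-vertex i with kind (S i) | others i
    ... | vertex v isV | _ = v , isV
    ... | hex h isH | j , k , r with P-vertex i | P-vertex j | P-vertex k
    ... | u , isU | v , isV | w , isW = ⊥-elim (S≁P i (≋-sym (Link⇒adjacent isU isH (link-closed h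
            (adjacent⇒Link isV isH (≋-sym (SP (first≢second r)))) (adjacent⇒Link isW isH (≋-sym (SP (first≢third r))))
            v≢w (vertices-adjacent isV isW (PP j k)) (IsVertex⇒Essential isV)
            (vertices-adjacent isU isV (PP i j)) (vertices-adjacent isU isW (PP i k))))))
      where
      v≢w : v ≢ w
      v≢w refl = P≢P (second≢third r) (IsVertex-injective isV isW)

    -- All six members now come from single vertices, which form a hexad `h` in the original graph.
    -- Its triangle vertices are essential, so its ears are pairwise adjacent.
    K²-hexad-free : ⊥
    K²-hexad-free = ears-not-complete h p012 (essential p201) (essential p102) (essential p012)
      where
      isP : ∀ i → IsVertex (P i) (proj₁ (P-vertex i))
      isP i = proj₂ (P-vertex i)
      isS : ∀ i → IsVertex (S i) (proj₁ (S-vertex i))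
      isS i = proj₂ (S-vertex i)
      h : Hex
      h = record
        { T   = proj₁ ∘ P-vertex
        ; E   = proj₁ ∘ S-vertex
        ; TT  = λ i j → vertices-adjacent (isP i) (isP j) (PP i j)
        ; ET  = λ {i} {j} i≢j → vertices-adjacent (isS i) (isP j) (SP i≢j)
        ; E≁T = λ i S~P → S≁P i (adjacent-vertices (isS i) (isP i) S~P) }
      essential : ∀ {i j k} → Perm i j k → E h j ~ E h k
      essential p = IsVertex⇒Essential (isP _) h p refl

-- Finite lists, injections and subsets.

module _ {n : ℕ} where

  all-allFin : ∀ {f : Fin n → Bool} → all f (allFin n) ≡ true ⇔ (∀ v → f v ≡ true)
  all-allFin {f} = mk⇔
    (λ eq v → Equivalence.to T-≡ (All.lookup (all⁺ f (allFin n) (Equivalence.from T-≡ eq)) (∈-allFin v)))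
    (λ eq → Equivalence.to T-≡ (all⁻ f {xs = allFin n} (All.tabulate λ {v} _ → Equivalence.from T-≡ (eq v))))

  any-allFin : ∀ {f : Fin n → Bool} → any f (allFin n) ≡ true ⇔ (∃ λ v → f v ≡ true)
  any-allFin {f} = mk⇔
    (λ eq → let v , _ , t = find (any⁻ f (allFin n) (Equivalence.from T-≡ eq)) in v , Equivalence.to T-≡ t)
    (λ (v , eq) → Equivalence.to T-≡ (any⁺ f (lose (∈-allFin v) (Equivalence.from T-≡ eq))))

module _ {A : Set} where

  lookup-injective : ∀ {xs : List A} → Unique xs → ∀ {i j} → lookup xs i ≡ lookup xs j → i ≡ j
  lookup-injective (x∉ ∷ u) {zero}  {zero}  eq = refl
  lookup-injective (x∉ ∷ u) {zero}  {suc j} eq = contradiction eq (All.lookup x∉ (∈-lookup j))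
  lookup-injective (x∉ ∷ u) {suc i} {zero}  eq = contradiction (sym eq) (All.lookup x∉ (∈-lookup i))
  lookup-injective (x∉ ∷ u) {suc i} {suc j} eq = cong suc (lookup-injective u eq)

  Unique-⊆⇒length≤ : ∀ {xs ys : List A} → Unique xs → (∀ {x} → x ∈ₗ xs → x ∈ₗ ys) → length xs ≤ length ys
  Unique-⊆⇒length≤ {xs} {ys} u xs⊆ys = injective⇒≤ {f = λ i → index (xs⊆ys (∈-lookup i))} λ {i} {j} eq →
    lookup-injective u (trans (lookup-index (xs⊆ys (∈-lookup i)))
      (trans (cong (lookup ys) eq) (sym (lookup-index (xs⊆ys (∈-lookup j))))))

injective⇒surjective : ∀ {m n} {f : Fin m → Fin n} → n ≤ m → (∀ {i j} → f i ≡ f j → i ≡ j) →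
                       ∀ v → ∃ λ i → f i ≡ v
injective⇒surjective {n = suc n} {f} n<m inj v with any? (λ i → f i ≟ v)
... | yes hit = hit
... | no miss = contradiction (injective⇒≤ {f = λ i → punchOut (v≢ i)}
                  λ {i} {j} eq → inj (punchOut-injective (v≢ i) (v≢ j) eq)) (<⇒≱ n<m)
  where
  v≢ : ∀ i → v ≢ f i
  v≢ i eq = miss (i , sym eq)

∈-allSubsets : ∀ {n} (S : VSet n) → S ∈ₗ allSubsets n
∈-allSubsets []          = here refl
∈-allSubsets (false ∷ S) = ∈-++⁺ˡ (∈-map⁺ (false ∷_) (∈-allSubsets S))
∈-allSubsets {suc n} (true ∷ S) = ∈-++⁺ʳ (map (false ∷_) (allSubsets n)) (∈-map⁺ (true ∷_) (∈-allSubsets S))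

allSubsets-unique : ∀ n → Unique (allSubsets n)
allSubsets-unique zero    = [] ∷ []
allSubsets-unique (suc n) = ++⁺ (map⁺ ∷-injectiveʳ (allSubsets-unique n)) (map⁺ ∷-injectiveʳ (allSubsets-unique n)) disjoint
  where
  disjoint : ∀ {S} → ¬ (S ∈ₗ map (false ∷_) (allSubsets n) × S ∈ₗ map (true ∷_) (allSubsets n))
  disjoint (S∈ , S∈′) with ∈-map⁻ (false ∷_) S∈ | ∈-map⁻ (true ∷_) S∈′
  ... | _ , _ , refl | _ , _ , ()

∧-true : ∀ {a b} → a ∧ b ≡ true → a ≡ true × b ≡ true
∧-true {true} eq = refl , eq

true-∧ : ∀ {a b} → a ≡ true → b ≡ true → a ∧ b ≡ true
true-∧ refl eq = eq

-- Graphs with Boolean adjacency as instances of the clique graph interface.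

R : (G : Graph) → Fin (size G) → Fin (size G) → Set
R G u v = u ≡ v ⊎ adj G u v ≡ true

In : (G : Graph) → Fin (size G) → Fin (size (K G)) → Set
In G v i = v ∈ᵇ lookup (cliques G) i ≡ true

R? : ∀ G u v → Dec (R G u v)
R? G u v = (u ≟ v) ⊎-dec (adj G u v ≟ᵇ true)

R⇒adj : ∀ G {u v} → u ≢ v → R G u v → adj G u v ≡ true
R⇒adj G u≢v (inj₁ u≡v) = contradiction u≡v u≢v
R⇒adj G u≢v (inj₂ adj) = adj

module _ (G : Graph) (simple : IsSimple G) where
  private
    V = Fin (size G)

  R-sym : ∀ {u v} → R G u v → R G v u
  R-sym (inj₁ eq)       = inj₁ (sym eq)
  R-sym {u} {v} (inj₂ adj) = inj₂ (trans (proj₁ simple v u) adj)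

  adj⇒≢ : ∀ {u v} → adj G u v ≡ true → u ≢ v
  adj⇒≢ {u} uv refl = contradiction (trans (sym uv) (proj₂ simple u)) λ ()

  -- Maximality takes the form of a decision with a witness, as required by `dichotomy`.
  record IsCliqueSet (S : VSet (size G)) : Set where
    field
      inhabited : ∃ λ v → v ∈ᵇ S ≡ true
      pairwise  : ∀ {u v} → u ∈ᵇ S ≡ true → v ∈ᵇ S ≡ true → R G u v
      maximal   : ∀ v → v ∈ᵇ S ≡ true ⊎ ∃ λ u → u ∈ᵇ S ≡ true × ¬ R G u v

  isClique⇒IsCliqueSet : ∀ {S} → isClique G S ≡ true → IsCliqueSet S
  isClique⇒IsCliqueSet {S} eq with isNonempty G S in ne | isComplete G S in co | isMaximal G S in ma
  ... | true | true | true = record { inhabited = Equivalence.to any-allFin ne ; pairwise = pw ; maximal = mx }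
    where
    pw : ∀ {u v} → u ∈ᵇ S ≡ true → v ∈ᵇ S ≡ true → R G u v
    pw {u} {v} u∈ v∈ with Equivalence.to all-allFin (Equivalence.to all-allFin co u) v
    ... | entry rewrite u∈ | v∈ with u ≟ v
    ...   | yes u≡v = inj₁ u≡v
    ...   | no _ = inj₂ entry
    mx : ∀ v → v ∈ᵇ S ≡ true ⊎ ∃ λ u → u ∈ᵇ S ≡ true × ¬ R G u v
    mx v with Equivalence.to all-allFin ma v
    ... | entry with v ∈ᵇ S in v∉
    ...   | true = inj₁ refl
    ...   | false with any? (λ u → (u ∈ᵇ S ≟ᵇ true) ×-dec ¬? (R? G u v))
    ...     | yes found = inj₂ found
    ...     | no none = contradiction (trans (sym entry) (cong not (Equivalence.from all-allFin all-adjacent))) λ ()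
      where
      all-adjacent : ∀ u → not (u ∈ᵇ S) ∨ adj G v u ≡ true
      all-adjacent u with u ∈ᵇ S in u∈
      ... | false = refl
      ... | true with R? G u v
      ...   | yes (inj₂ uv) = trans (proj₁ simple v u) uv
      ...   | yes (inj₁ refl) = contradiction (trans (sym u∈) v∉) λ ()
      ...   | no ¬r = contradiction (u , u∈ , ¬r) none

  IsCliqueSet⇒isClique : ∀ {S} → IsCliqueSet S → isClique G S ≡ true
  IsCliqueSet⇒isClique {S} c = true-∧ (Equivalence.from any-allFin (IsCliqueSet.inhabited c))
    (true-∧ (Equivalence.from all-allFin λ i → Equivalence.from all-allFin (entry i)) (Equivalence.from all-allFin mx))
    where
    entry : ∀ i j → not (i ∈ᵇ S ∧ j ∈ᵇ S ∧ not (i == j)) ∨ adj G i j ≡ true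
    entry i j with i ∈ᵇ S in i∈ | j ∈ᵇ S in j∈ | i ≟ j
    ... | false | _     | _     = refl
    ... | true  | false | _     = refl
    ... | true  | true  | yes _ = refl
    ... | true  | true  | no i≢j = R⇒adj G i≢j (IsCliqueSet.pairwise c i∈ j∈)
    mx : ∀ v → not (not (v ∈ᵇ S) ∧ all (λ u → not (u ∈ᵇ S) ∨ adj G v u) (allFin (size G))) ≡ true
    mx v with IsCliqueSet.maximal c v
    ... | inj₁ v∈ rewrite v∈ = refl
    ... | inj₂ (u , u∈ , ¬r) with all (λ u → not (u ∈ᵇ S) ∨ adj G v u) (allFin (size G)) in al
    ...   | false = cong not (∧-zeroʳ (not (v ∈ᵇ S)))
    ...   | true with Equivalence.to all-allFin al u
    ...     | vu rewrite u∈ = contradiction (R-sym (inj₂ vu)) ¬r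

  member-clique : ∀ i → IsCliqueSet (lookup (cliques G) i)
  member-clique i = isClique⇒IsCliqueSet
    (proj₂ (∈-filter⁻ (λ S → isClique G S ≟ᵇ true) {xs = allSubsets (size G)} (∈-lookup i)))

  clique-index : ∀ {S} → IsCliqueSet S → ∃ λ i → lookup (cliques G) i ≡ S
  clique-index {S} c = index S∈ , sym (lookup-index S∈)
    where
    S∈ : S ∈ₗ cliques G
    S∈ = ∈-filter⁺ (λ S → isClique G S ≟ᵇ true) (∈-allSubsets S) (IsCliqueSet⇒isClique c)

  Pairwise : List V → Set
  Pairwise L = ∀ {u v} → u ∈ₗ L → v ∈ₗ L → R G u v

  -- A greedy extension: each candidate from `M` is added if it is adjacent to all vertices chosen
  -- so far. The witness against a rejected candidate stays valid because the list only grows.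
  saturate : ∀ M L → Pairwise L → ∃ λ L′ → (∀ {v} → v ∈ₗ L → v ∈ₗ L′) × Pairwise L′ ×
             (∀ {v} → v ∈ₗ M → v ∈ₗ L′ ⊎ ∃ λ u → u ∈ₗ L′ × ¬ R G u v)
  saturate [] L pw = L , (λ v∈ → v∈) , pw , λ ()
  saturate (v ∷ M) L pw with All.all? (λ u → R? G u v) L
  ... | yes adjacent with saturate M (v ∷ L) pw′
    where
    pw′ : Pairwise (v ∷ L)
    pw′ (here refl) (here refl) = inj₁ refl
    pw′ (here refl) (there w∈)  = R-sym (All.lookup adjacent w∈)
    pw′ (there u∈)  (here refl) = All.lookup adjacent u∈
    pw′ (there u∈)  (there w∈)  = pw u∈ w∈
  ...   | L′ , ⊆L′ , pwL′ , mx = L′ , ⊆L′ ∘ there , pwL′ ,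
            λ { (here refl) → inj₁ (⊆L′ (here refl)) ; (there w∈) → mx w∈ }
  saturate (v ∷ M) L pw | no ¬adjacent with find (¬All⇒Any¬ (λ u → R? G u v) L ¬adjacent) | saturate M L pw
  ...   | u , u∈ , ¬r | L′ , ⊆L′ , pwL′ , mx = L′ , ⊆L′ , pwL′ ,
            λ { (here refl) → inj₂ (u , ⊆L′ u∈ , ¬r) ; (there w∈) → mx w∈ }

  list-clique : ∀ {w} L → w ∈ₗ L → Pairwise L → (∀ v → v ∈ₗ L ⊎ ∃ λ u → u ∈ₗ L × ¬ R G u v) →
                ∃ λ i → ∀ {v} → v ∈ₗ L → In G v i
  list-clique {w} L w∈ pw mx = proj₁ found , λ {v} v∈ → trans (cong (v ∈ᵇ_) (proj₂ found)) (to-S v∈)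
    where
    S : VSet (size G)
    S = tabulate λ v → does (_∈?_ _≟_ v L)
    to-S : ∀ {v} → v ∈ₗ L → v ∈ᵇ S ≡ true
    to-S {v} v∈ = trans (lookup∘tabulate _ v) (dec-true (_∈?_ _≟_ v L) v∈)
    from-S : ∀ {v} → v ∈ᵇ S ≡ true → v ∈ₗ L
    from-S {v} v∈ with _∈?_ _≟_ v L | lookup∘tabulate (λ v → does (_∈?_ _≟_ v L)) v
    ... | yes v∈L | _  = v∈L
    ... | no _    | eq = contradiction (trans (sym v∈) eq) λ ()
    found : ∃ λ i → lookup (cliques G) i ≡ S
    found = clique-index record
      { inhabited = w , to-S w∈
      ; pairwise  = λ u∈ v∈ → pw (from-S u∈) (from-S v∈)
      ; maximal   = λ v → [ inj₁ ∘ to-S , (λ (u , u∈ , ¬r) → inj₂ (u , to-S u∈ , ¬r)) ]′ (mx v) }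

  extend-to-clique : ∀ u L → Pairwise (u ∷ L) → ∃ λ i → ∀ {v} → v ∈ₗ (u ∷ L) → In G v i
  extend-to-clique u L pw with saturate (allFin (size G)) (u ∷ L) pw
  ... | L′ , ⊆L′ , pwL′ , mx with list-clique L′ (⊆L′ (here refl)) pwL′ (λ v → mx (∈-allFin v))
  ...   | i , L′⊆i = i , L′⊆i ∘ ⊆L′

  -- Maximality of the smaller clique turns the inclusion into equality of characteristic vectors,
  -- and the list of cliques has no repetitions.
  In-antichain : ∀ {i j} → (∀ {v} → In G v i → In G v j) → i ≡ j
  In-antichain {i} {j} i⊆j = lookup-injective (filter⁺ (λ S → isClique G S ≟ᵇ true) (allSubsets-unique (size G)))
    (trans (sym (tabulate∘lookup _)) (trans (tabulate-cong λ v → ⇔→≡ (mk⇔ i⊆j (j⊆i v))) (tabulate∘lookup _)))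
    where
    j⊆i : ∀ v → In G v j → In G v i
    j⊆i v v∈j with IsCliqueSet.maximal (member-clique i) v
    ... | inj₁ v∈i = v∈i
    ... | inj₂ (u , u∈i , ¬r) = contradiction (IsCliqueSet.pairwise (member-clique j) (i⊆j u∈i) v∈j) ¬r

  R-K⇒common : ∀ {i j} → R (K G) i j → ∃ λ v → In G v i × In G v j
  R-K⇒common {i} (inj₁ refl) with IsCliqueSet.inhabited (member-clique i)
  ... | v , v∈ = v , v∈ , v∈
  R-K⇒common {i} {j} (inj₂ eq) with ∧-true eq
  ... | _ , meet with Equivalence.to any-allFin meet
  ... | v , both = v , ∧-true both

  common⇒R-K : ∀ {i j v} → In G v i → In G v j → R (K G) i j
  common⇒R-K {i} {j} {v} v∈i v∈j with i ≟ j
  ... | yes i≡j = inj₁ i≡j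
  ... | no i≢j = inj₂ (Equivalence.from any-allFin (v , true-∧ v∈i v∈j))

  K-isCliqueGraph : IsCliqueGraph (R G) (R (K G)) (In G)
  K-isCliqueGraph = record
    { ~-refl    = inj₁ refl
    ; ~-sym     = R-sym
    ; complete  = λ {_} {_} {i} → IsCliqueSet.pairwise (member-clique i)
    ; dichotomy = λ v i → IsCliqueSet.maximal (member-clique i) v
    ; nonempty  = λ i → IsCliqueSet.inhabited (member-clique i)
    ; elements  = λ i → filter (In? i) (allFin (size G)) , λ v →
        mk⇔ (λ v∈ → proj₂ (∈-filter⁻ (In? i) {xs = allFin (size G)} v∈)) (∈-filter⁺ (In? i) (∈-allFin v))
    ; extend    = extend-to-clique
    ; ≈⇒common  = R-K⇒common
    ; common⇒≈  = common⇒R-K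
    ; antichain = In-antichain }
    where
    In? : ∀ i v → Dec (In G v i)
    In? i v = (v ∈ᵇ lookup (cliques G) i) ≟ᵇ true

  K-simple : IsSimple (K G)
  K-simple = (λ i j → ⇔→≡ (mk⇔ (flip-adj i j) (flip-adj j i))) , irreflexive
    where
    irreflexive : ∀ i → adj (K G) i i ≡ false
    irreflexive i with i ≟ i
    ... | yes _  = refl
    ... | no i≢i = contradiction refl i≢i
    flip-adj : ∀ i j → adj (K G) i j ≡ true → adj (K G) j i ≡ true
    flip-adj i j ij with R-K⇒common (inj₂ ij)
    ... | v , v∈i , v∈j = R⇒adj (K G) j≢i (common⇒R-K v∈j v∈i)
      where
      j≢i : j ≢ i
      j≢i refl = contradiction (trans (sym ij) (irreflexive i)) λ ()

  degree⇒length≤ : ∀ {d} → MaxDegreeAtMost d G → ∀ v {L} → Unique L → All (R G v) L → length L ≤ suc d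
  degree⇒length≤ deg v {L} unique adjacent = ≤-trans (Unique-⊆⇒length≤ unique closed) (s≤s (deg v))
    where
    closed : ∀ {u} → u ∈ₗ L → u ∈ₗ (v ∷ filter (λ u → adj G v u ≟ᵇ true) (allFin (size G)))
    closed u∈ with All.lookup adjacent u∈
    ... | inj₁ refl = here refl
    ... | inj₂ vu   = there (∈-filter⁺ (λ u → adj G v u ≟ᵇ true) (∈-allFin _) vu)

-- Isomorphisms and the convergence of clique-Helly graphs.

bijection⇒≅ : ∀ G H (f : Fin (size H) → Fin (size G)) → (∀ {i j} → f i ≡ f j → i ≡ j) →
              (∀ v → ∃ λ i → f i ≡ v) → (∀ i j → adj H i j ≡ adj G (f i) (f j)) → G ≅ H
bijection⇒≅ G H f inj surj adj-f = mk↔ₛ′ (proj₁ ∘ surj) f (λ i → inj (proj₂ (surj (f i)))) (proj₂ ∘ surj) ,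
  λ u v → trans (sym (cong₂ (adj G) (proj₂ (surj u)) (proj₂ (surj v)))) (sym (adj-f _ _))

-- An injection into a set that is no larger is onto, and injectivity lets the loops of `R` be
-- removed on both sides.
embedding⇒≅ : ∀ G H → IsSimple G → IsSimple H → (f : Fin (size H) → Fin (size G)) →
              (∀ {i j} → f i ≡ f j → i ≡ j) → (∀ {i j} → R H i j → R G (f i) (f j)) →
              (∀ {i j} → R G (f i) (f j) → R H i j) → size G ≤ size H → G ≅ H
embedding⇒≅ G H simpleG simpleH f inj preserves reflects G≤H =
  bijection⇒≅ G H f inj (injective⇒surjective G≤H inj) λ i j → ⇔→≡ (mk⇔
    (λ ij → R⇒adj G (adj⇒≢ H simpleH ij ∘ inj) (preserves (inj₂ ij)))
    (λ ij → R⇒adj H (adj⇒≢ G simpleG ij ∘ cong f) (reflects (inj₂ ij))))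

Kⁿ-K : ∀ m G → Kⁿ m (K G) ≡ Kⁿ (suc m) G
Kⁿ-K zero    G = refl
Kⁿ-K (suc m) G = cong K (Kⁿ-K m G)

Convergent-K⇒Convergent : ∀ G → Convergent (K G) → Convergent G
Convergent-K⇒Convergent G (m , n , m<n , iso) =
  suc m , suc n , s≤s m<n , subst₂ _≅_ (Kⁿ-K m G) (Kⁿ-K n G) iso

module KHelly (G : Graph) (simple : IsSimple G) =
  Helly (K-isCliqueGraph G simple) (K-isCliqueGraph (K G) (K-simple G simple))

Helly⇒Convergent : ∀ G simple → Acc _<_ (size G) → KHelly.IsHelly G simple → Convergent G
Helly⇒Convergent G simple (acc smaller) helly with size G ≤? size (K (K G))
... | yes G≤ = 0 , 2 , s≤s z≤n , embedding⇒≅ G (K (K G)) simple (K-simple (K G) (K-simple G simple))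
                 (centre helly) (centre-injective helly) (centre-adjacent helly) (adjacent-centre helly) G≤
  where open KHelly G simple
... | no G≰ = Convergent-K⇒Convergent G (Convergent-K⇒Convergent (K G)
                (Helly⇒Convergent (K (K G)) simple″ (smaller (≰⇒> G≰)) helly″))
  where
  simple′ = K-simple G simple
  simple″ = K-simple (K G) simple′
  simple‴ = K-simple (K (K G)) simple″
  helly″ : KHelly.IsHelly (K (K G)) simple″
  -- The Helly property passes from `G` to `K G` and from there to `K (K G)`.
  helly″ = KHelly.Helly⇒Helly-K (K G) simple′
    (KHelly.Helly⇒Helly-K G simple helly (K-isCliqueGraph (K (K G)) simple″))
    (K-isCliqueGraph (K (K (K G))) simple‴)

-- Recognizing the octahedron.

part : Fin 6 → Fin 3
part 0F = 0F
part 1F = 0F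
part 2F = 1F
part 3F = 1F
part 4F = 2F
part 5F = 2F

-- Each part of the octahedron will consist of a triangle vertex and the ear not adjacent to it;
-- `inner` marks the former.
inner : Fin 6 → Bool
inner 0F = true
inner 1F = false
inner 2F = true
inner 3F = false
inner 4F = true
inner 5F = false

corner : Fin 3 → Bool → Fin 6
corner 0F true  = 0F
corner 0F false = 1F
corner 1F true  = 2F
corner 1F false = 3F
corner 2F true  = 4F
corner 2F false = 5F

corner-part-inner : ∀ i → corner (part i) (inner i) ≡ i
corner-part-inner = λ { 0F → refl ; 1F → refl ; 2F → refl ; 3F → refl ; 4F → refl ; 5F → refl }

part-corner : ∀ l b → part (corner l b) ≡ l × inner (corner l b) ≡ b
part-corner 0F true  = refl , refl
part-corner 0F false = refl , refl
part-corner 1F true  = refl , refl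
part-corner 1F false = refl , refl
part-corner 2F true  = refl , refl
part-corner 2F false = refl , refl

toℕ-part : ∀ i → toℕ (part i) ≡ toℕ i / 2
toℕ-part = λ { 0F → refl ; 1F → refl ; 2F → refl ; 3F → refl ; 4F → refl ; 5F → refl }

module Octahedral (G : Graph) (simple : IsSimple G) (connected : Connected G)
                  (deg : MaxDegreeAtMost 4 G) (h : Hexad (R G))
                  (EE : ∀ i j → R G (Hexad.E h i) (Hexad.E h j)) where
  open Hexad h
  open Saturation (K-isCliqueGraph G simple) _≟_ (degree⇒length≤ G simple deg)

  -- Exchanging triangle and ears lets `near` bound the neighbourhoods of the ears as well, so no
  -- edge leaves the six vertices and connectedness makes them all of `G`.
  opposite : Hexad (R G)
  opposite = record
    { T = E ; E = T ; TT = EE ; ET = λ i≢j → R-sym G simple (ET (i≢j ∘ sym)) ; E≁T = λ i r → E≁T i (R-sym G simple r) }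

  point : Fin 3 → Bool → Fin (size G)
  point l true  = T l
  point l false = E l

  point-adjacent : ∀ {l m} → l ≢ m → ∀ b c → adj G (point l b) (point m c) ≡ true
  point-adjacent l≢m true  true  = R⇒adj G (T≢T h l≢m) (TT _ _)
  point-adjacent l≢m true  false = R⇒adj G (E≢T h _ _ ∘ sym) (R-sym G simple (ET (l≢m ∘ sym)))
  point-adjacent l≢m false true  = R⇒adj G (E≢T h _ _) (ET l≢m)
  point-adjacent l≢m false false = R⇒adj G (E≢E h l≢m) (EE _ _)

  point-nonadjacent : ∀ l b c → ¬ (adj G (point l b) (point l c) ≡ true)
  point-nonadjacent l true  true  uv = adj⇒≢ G simple uv refl
  point-nonadjacent l true  false uv = E≁T l (R-sym G simple (inj₂ uv))
  point-nonadjacent l false true  uv = E≁T l (inj₂ uv)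
  point-nonadjacent l false false uv = adj⇒≢ G simple uv refl

  vertex : Fin 6 → Fin (size G)
  vertex i = point (part i) (inner i)

  point-vertex : ∀ l b → ∃ λ i → vertex i ≡ point l b
  point-vertex l b = corner l b , cong₂ point (proj₁ (part-corner l b)) (proj₂ (part-corner l b))

  point-injective : ∀ l m b c → point l b ≡ point m c → corner l b ≡ corner m c
  point-injective l m b c eq with l ≟ m
  ... | no l≢m = contradiction eq (adj⇒≢ G simple (point-adjacent l≢m b c))
  point-injective l m true  true  eq | yes refl = refl
  point-injective l m true  false eq | yes refl = contradiction (sym eq) (E≢T h l l)
  point-injective l m false true  eq | yes refl = contradiction eq (E≢T h l l)
  point-injective l m false false eq | yes refl = refl

  vertex-injective : ∀ {i j} → vertex i ≡ vertex j → i ≡ j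
  vertex-injective {i} {j} eq = trans (sym (corner-part-inner i))
    (trans (point-injective (part i) (part j) (inner i) (inner j) eq) (corner-part-inner j))

  neighbour : ∀ {v} l b → R G v (point l b) → ∃ λ i → vertex i ≡ v
  neighbour l true r with near h r
  ... | at-T j refl   = point-vertex j true
  ... | at-E j _ refl = point-vertex j false
  neighbour l false r with near opposite r
  ... | at-T j refl   = point-vertex j false
  ... | at-E j _ refl = point-vertex j true

  reach : ∀ {u v} → Reachable G u v → (∃ λ i → vertex i ≡ u) → ∃ λ i → vertex i ≡ v
  reach here       hit        = hit
  reach (step e r) (i , refl) = reach r (neighbour (part i) (inner i) (R-sym G simple (inj₂ e)))

  vertex-adjacent : ∀ i j → adj octahedron i j ≡ adj G (vertex i) (vertex j)
  vertex-adjacent i j with toℕ i / 2 ≟ⁿ toℕ j / 2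
  ... | no ≢ = sym (point-adjacent (λ eq → ≢ (trans (sym (toℕ-part i)) (trans (cong toℕ eq) (toℕ-part j)))) (inner i) (inner j))
  ... | yes eq = sym (¬-not λ uv → point-nonadjacent (part i) (inner i) (inner j)
                   (trans (cong (λ l → adj G (vertex i) (point l (inner j))) same-part) uv))
    where
    same-part : part i ≡ part j
    same-part = toℕ-injective (trans (toℕ-part i) (trans eq (sym (toℕ-part j))))

  ≅octahedron : G ≅ octahedron
  ≅octahedron = bijection⇒≅ G octahedron vertex vertex-injective
    (λ v → reach (proj₂ connected (T 0F) v) (point-vertex 0F true)) vertex-adjacent

mainTheorem1 : (G : Graph) → IsSimple G → Connected G → MaxDegreeAtMost 4 G
    → ¬ (G ≅ octahedron) → Convergent G
mainTheorem1 G simple connected deg ¬octahedron = Convergent-K⇒Convergent G (Convergent-K⇒Convergent (K G)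
  (Helly⇒Convergent (K (K G)) simple″ (<-wellFounded _)
    (KHelly.hexad-free⇒Helly (K (K G)) simple″ K²-hexad-free)))
  where
  simple′ = K-simple G simple
  simple″ = K-simple (K G) simple′
  open LowDegree (K-isCliqueGraph G simple) (K-isCliqueGraph (K G) simple′) _≟_ (R? G)
    (degree⇒length≤ G simple deg)
    (λ h EE → ¬octahedron (Octahedral.≅octahedron G simple connected deg h EE))
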